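{- Let $G=(V,E)$ be a graph, $R=\{r_1,\dots,r_t\}$ a multiset of vertices of $V$, and $\mathcal{M}$ a matroid on $R$ of rank $k$ with rank function $r_{\mathcal{M}}:2^{R}\to\mathbb{Z}$. Then $(G,R)$ can be decomposed into rooted-components $(C_1,r_1),\dots,(C_t,r_t)$ such that the multiset $\{r_i\in R\mid v\in V(C_i,r_i)\}$ is a spanning set of $\mathcal{M}$ for every $v\in V$ if and only if $$|\delta_G(\mathcal{P})|\ \ge\ k|\mathcal{P}|-\sum_{X\in\mathcal{P}} r_{\mathcal{M}}(R_X)$$ for every partition $\mathcal{P}$ of $V$ into non-empty subsets.
   Context: Graphs are finite and undirected. For $F\subseteq E$, $V(F)$ is the set of vertices incident to edges of $F$. The multiset $R=\{r_1,\dots,r_t\}$ is regarded as a family indexed by $1,\dots,t$ (different indices are different elements of $R$); a matroid on $R$ has these $t$ elements as ground set. For $X\subseteq V$, $R_X=\{r_i\in R\mid r_i\in X\}$ as a multi-subset. A pair $(C,r)$ with $C\subseteq E$, $r\in V$ is a rooted-component if either $C=\emptyset$, or $C$ is connected and $r\in V(C)$. Put $V(C,r)=V(C)\cup\{r\}$. A decomposition of $(G,R)$ into rooted-components $(C_1,r_1),\dots,(C_t,r_t)$ means that $C_1,\dots,C_t$ are pairwise disjoint with union $E$ (empty $C_i$ allowed) and each $(C_i,r_i)$ is a rooted-component. For a partition $\mathcal{P}$ of $V$, $|\mathcal{P}|$ is the number of its parts and $\delta_G(\mathcal{P})$ is the set of edges of $G$ connecting two distinct parts of $\mathcal{P}$.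 A spanning set of $\mathcal{M}$ is a set whose rank equals the rank of $\mathcal{M}$.
   Formalization: The rank k of the matroid is assumed to be at least 1; for k = 0 the claim fails, e.g. for a graph with a single edge and R empty, where the inequality holds but no component can contain the edge. -}

module Defs where

open import Data.Nat using (ℕ; zero; suc; _<_)
open import Data.Nat.Properties using (+-0-commutativeMonoid)
open import Data.Fin using (Fin)
open import Data.Fin.Properties using (any?; _≟_)
open import Data.Fin.Subset
  using (Subset; inside; outside; ⊥; ⊤; ⁅_⁆; _∈_; _∉_; _⊆_; _∩_; _∪_; ∣_∣; Nonempty; Empty)
open import Data.Fin.Subset.Properties using (_∈?_; _⊆?_)
open import Data.List using (List; []; _∷_; [_]; _++_; map; filter)
open import Data.List.Extrema.Nat using (max)
open import Data.Product using (_×_; _,_; ∃; ∃-syntax; proj₁; proj₂)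
open import Data.Sum using (_⊎_)
open import Data.Vec using (tabulate) renaming ([] to []ᵥ; _∷_ to _∷ᵥ_)
open import Level using (0ℓ)
open import Relation.Binary.Construct.Closure.ReflexiveTransitive using (Star)
open import Relation.Binary.PropositionalEquality using (_≡_; _≢_)
open import Relation.Nullary using (does; ¬?; _×-dec_; _⊎-dec_)
open import Relation.Unary using (Pred; Decidable)

open import Algebra.Properties.CommutativeMonoid.Sum +-0-commutativeMonoid public
  using (sum)

setOf : ∀ {n} {P : Pred (Fin n) 0ℓ} → Decidable P → Subset n
setOf P? = tabulate λ i → does (P? i)

subsets : ∀ n → List (Subset n)
subsets zero    = [ []ᵥ ]
subsets (suc n) = map (inside ∷ᵥ_) (subsets n) ++ map (outside ∷ᵥ_) (subsets n)

record Matroid (t : ℕ) : Set₁ where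
  field
    Indep        : Pred (Subset t) 0ℓ
    -- Automatic classically; needed here for the rank to be a function.
    indep?       : Decidable Indep
    indep-⊥      : Indep ⊥
    indep-⊆      : ∀ {I J} → I ⊆ J → Indep J → Indep I
    augmentation : ∀ {I J} → Indep I → Indep J → ∣ I ∣ < ∣ J ∣ →
                   ∃[ e ] e ∈ J × e ∉ I × Indep (I ∪ ⁅ e ⁆)

  rank : Subset t → ℕ
  rank X = max 0 (map ∣_∣ (filter (λ I → indep? I ×-dec (I ⊆? X)) (subsets t)))

  Spanning : Subset t → Set
  Spanning X = rank X ≡ rank ⊤

-- A finite undirected multigraph on vertex set Fin n with edge set Fin m.
-- Parallel edges and loops are allowed; the order of the two components of
-- ends e carries no meaning.
record Graph (n m : ℕ) : Set where
  field
    ends : Fin m → Fin n × Fin n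

  Incident : Fin n → Fin m → Set
  Incident v e = v ≡ proj₁ (ends e) ⊎ v ≡ proj₂ (ends e)

  incident? : ∀ v → Decidable (Incident v)
  incident? v e = (v ≟ proj₁ (ends e)) ⊎-dec (v ≟ proj₂ (ends e))

  V[_] : Subset m → Subset n
  V[ F ] = setOf λ v → any? λ e → (e ∈? F) ×-dec incident? v e

  Adjacent : Subset m → Fin n → Fin n → Set
  Adjacent F u v = ∃[ e ] e ∈ F × (ends e ≡ (u , v) ⊎ ends e ≡ (v , u))

  -- Connectedness of the subgraph (V(F), F).
  Connected : Subset m → Set
  Connected F = ∀ {u v} → u ∈ V[ F ] → v ∈ V[ F ] → Star (Adjacent F) u v

  RootedComponent : Subset m → Fin n → Set
  RootedComponent C r = C ≡ ⊥ ⊎ (Connected C × r ∈ V[ C ])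

  Vᵣ : Subset m → Fin n → Subset n
  Vᵣ C r = V[ C ] ∪ ⁅ r ⁆

  record IsDecomposition {t} (root : Fin t → Fin n) (C : Fin t → Subset m) : Set where
    field
      disjoint  : ∀ {i j} → i ≢ j → Empty (C i ∩ C j)
      covers    : ∀ e → ∃[ i ] e ∈ C i
      component : ∀ i → RootedComponent (C i) (root i)

  rootsReaching : ∀ {t} → (Fin t → Fin n) → (Fin t → Subset m) → Fin n → Subset t
  rootsReaching root C v = setOf λ i → v ∈? Vᵣ (C i) (root i)

-- The i-th element of the multiset of roots is the index i, located at the
-- vertex root i; this is R_X.
rootsIn : ∀ {n t} → (Fin t → Fin n) → Subset n → Subset t
rootsIn root X = setOf λ i → root i ∈? X

record Partition (n : ℕ) : Set where
  field
    size     : ℕ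
    part     : Fin size → Subset n
    nonempty : ∀ i → Nonempty (part i)
    disjoint : ∀ {i j} → i ≢ j → Empty (part i ∩ part j)
    covers   : ∀ v → ∃[ i ] v ∈ part i

module _ {n m} (G : Graph n m) (P : Partition n) where
  open Graph G
  open Partition P

  δ : Subset m
  δ = setOf λ e → any? λ i → any? λ j →
        ¬? (i ≟ j) ×-dec (proj₁ (ends e) ∈? part i) ×-dec (proj₂ (ends e) ∈? part j)

{-# OPTIONS --safe #-}

-- Necessity: for a part X with representative x, the roots reaching x are those
-- in X plus those entering X along their component, so k ≤ r(R_X) + #entering;
-- a connected component that enters j parts uses at least j edges of δ(P).
--
-- Sufficiency: let S v be the set of roots reaching v, f(X) the rank of the
-- union of S v over v ∈ X, and i(X) the number of unassigned edges inside X.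
-- Keep a demand w : V → ℕ with w(X) + f(X) ≥ i(X) + k for all nonempty X and
-- w(V) ≤ number of unassigned edges; call X tight if equality holds.  It exists
-- at the start: lower w as long as some vertex lies in no tight set; afterwards
-- tight sets, being closed under intersecting unions, contain a partition, whose
-- condition bounds w(V).
-- While some S v is not spanning, some unassigned edge xy and s ∈ S x outside
-- the span of S y can be used to add s to S y, lowering w y by one: a tight set
-- blocking the choice (x, y, s) contains a new choice inside a smaller tight set.
-- Once every S v spans, the remaining edges can be given to any component at
-- one of their ends.

module Submission where

open import Defs
open import Data.Bool using (Bool; true; false)
open import Data.Nat using (ℕ; zero; suc; pred; _+_; _∸_; _≤_; _<_; z≤n; s≤s; s≤s⁻¹)
open import Data.Nat.Properties
open import Algebra.Properties.CommutativeMonoid.Sum +-0-commutativeMonoid using (∑-comm; ∑-distrib-+; sum-cong-≗)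
open import Algebra.Properties.CommutativeSemigroup +-commutativeSemigroup using (interchange; x∙yz≈y∙xz; xy∙z≈xz∙y)
import Data.Empty
import Data.Nat as ℕ
open import Data.Fin using (Fin; zero; suc)
open import Data.Fin.Properties using (any?; all?; ¬∀⟶∃¬) renaming (_≟_ to _≟ᶠ_; suc-injective to sucᶠ-injective)
open import Data.Fin.Subset
  using (Subset; inside; outside; ⊥; ⊤; ⁅_⁆; _∈_; _∉_; _⊆_; _⊂_; _∩_; _∪_; _─_; ∣_∣; Nonempty; Empty)
  renaming (_-_ to _-ˢ_)
open import Data.Fin.Subset.Properties
open import Data.List using (List; []; _∷_; length; lookup; allFin)
open import Data.List.Extrema.Nat using (argmax-sel; xs≤max)
open import Data.List.Membership.Propositional using () renaming (_∈_ to _∈ᴸ_)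
open import Data.List.Membership.Propositional.Properties
  using (∈-lookup; ∈-allFin; ∈-map⁺; ∈-map⁻; ∈-filter⁺; ∈-filter⁻; ∈-++⁺ˡ; ∈-++⁺ʳ)
open import Data.List.Relation.Unary.All as All using (All; []; _∷_)
open import Data.List.Relation.Unary.Any as Any using (Any; here; there)
open import Data.List.Relation.Unary.Any.Properties using (lookup-index)
open import Data.List.Relation.Unary.AllPairs using (AllPairs; []; _∷_)
open import Data.Product using (_×_; _,_; ∃; ∃-syntax; proj₁; proj₂)
open import Data.Sum using (_⊎_; inj₁; inj₂; [_,_]′)
open import Data.Vec as Vec using (Vec; []; _∷_; replicate; updateAt)
open import Data.Vec.Properties using (lookup-replicate; lookup∘tabulate; lookup⇒[]=; []=⇒lookup)
open import Function using (_∘_)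
open import Function.Bundles using (_⇔_; mk⇔; Equivalence)
open import Level using (0ℓ)
open import Relation.Binary.Construct.Closure.ReflexiveTransitive as Star using (Star; ε; _◅_; _◅◅_)
open import Relation.Binary.PropositionalEquality using (_≡_; _≢_; refl; sym; trans; cong; cong₂; subst; subst₂; module ≡-Reasoning)
open import Relation.Nullary using (Dec; yes; no; ¬_; does; ¬?; _×-dec_; _⊎-dec_; contradiction)
open import Relation.Nullary.Decidable using (decidable-stable; dec-true)
open import Relation.Unary using (Pred; Decidable)
import Data.Integer as ℤ
import Data.Integer.Properties as ℤₚ

-- Membership in sets given by decidable predicates, and in differences

∈-setOf⁺ : ∀ {n} {P : Pred (Fin n) 0ℓ} (P? : Decidable P) {i} → P i → i ∈ setOf P?
∈-setOf⁺ P? {i} p = lookup⇒[]= i _ (trans (lookup∘tabulate _ i) (dec-true (P? i) p))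

∈-setOf⁻ : ∀ {n} {P : Pred (Fin n) 0ℓ} (P? : Decidable P) {i} → i ∈ setOf P? → P i
∈-setOf⁻ P? {i} i∈ with P? i | trans (sym (lookup∘tabulate (does ∘ P?) i)) ([]=⇒lookup i∈)
... | yes p | _  = p
... | no _  | ()

∈-─⁻ : ∀ {n} (p q : Subset n) {x} → x ∈ p ─ q → x ∈ p × x ∉ q
∈-─⁻ p q {x} x∈ = p─q⊆p p q x∈ , go p q x∈
  where
  go : ∀ {n} (p q : Subset n) {x} → x ∈ p ─ q → x ∉ q
  go (_ ∷ p) (inside ∷ q)  {zero}  ()         Vec.here
  go (_ ∷ p) (_ ∷ q)       {suc x} (Vec.there x∈) (Vec.there x∈q) = go p q x∈ x∈q

∈-remove⁻ : ∀ {n} (p : Subset n) {x y} → x ∈ p -ˢ y → x ∈ p × x ≢ y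
∈-remove⁻ p {x} {y} x∈ with ∈-─⁻ p ⁅ y ⁆ x∈
... | x∈p , x∉ = x∈p , λ { refl → x∉ (x∈⁅x⁆ x) }

-- Weights and cardinalities of subsets

weight : ∀ {n} → Vec ℕ n → Subset n → ℕ
weight []      []            = 0
weight (a ∷ w) (inside ∷ X)  = a + weight w X
weight (a ∷ w) (outside ∷ X) = weight w X

weight-modular : ∀ {n} (w : Vec ℕ n) X Y →
  weight w (X ∩ Y) + weight w (X ∪ Y) ≡ weight w X + weight w Y
weight-modular []      []            []            = refl
weight-modular (a ∷ w) (inside ∷ X)  (inside ∷ Y)  = begin
  (a + weight w (X ∩ Y)) + (a + weight w (X ∪ Y))   ≡⟨ interchange a _ a _ ⟩
  (a + a) + (weight w (X ∩ Y) + weight w (X ∪ Y))   ≡⟨ cong ((a + a) +_) (weight-modular w X Y) ⟩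
  (a + a) + (weight w X + weight w Y)               ≡⟨ interchange a a (weight w X) _ ⟩
  (a + weight w X) + (a + weight w Y)               ∎
  where open ≡-Reasoning
weight-modular (a ∷ w) (inside ∷ X)  (outside ∷ Y) = begin
  weight w (X ∩ Y) + (a + weight w (X ∪ Y))   ≡⟨ x∙yz≈y∙xz (weight w (X ∩ Y)) a _ ⟩
  a + (weight w (X ∩ Y) + weight w (X ∪ Y))   ≡⟨ cong (a +_) (weight-modular w X Y) ⟩
  a + (weight w X + weight w Y)               ≡⟨ +-assoc a _ _ ⟨
  (a + weight w X) + weight w Y               ∎
  where open ≡-Reasoning
weight-modular (a ∷ w) (outside ∷ X) (inside ∷ Y)  = begin
  weight w (X ∩ Y) + (a + weight w (X ∪ Y))   ≡⟨ x∙yz≈y∙xz (weight w (X ∩ Y)) a _ ⟩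
  a + (weight w (X ∩ Y) + weight w (X ∪ Y))   ≡⟨ cong (a +_) (weight-modular w X Y) ⟩
  a + (weight w X + weight w Y)               ≡⟨ x∙yz≈y∙xz a (weight w X) _ ⟩
  weight w X + (a + weight w Y)               ∎
  where open ≡-Reasoning
weight-modular (a ∷ w) (outside ∷ X) (outside ∷ Y) = weight-modular w X Y

weight-mono : ∀ {n} (w : Vec ℕ n) {X Y} → X ⊆ Y → weight w X ≤ weight w Y
weight-mono []      {[]}          {[]}          X⊆Y = z≤n
weight-mono (a ∷ w) {outside ∷ X} {outside ∷ Y} X⊆Y = weight-mono w (drop-∷-⊆ X⊆Y)
weight-mono (a ∷ w) {outside ∷ X} {inside ∷ Y}  X⊆Y = m≤n⇒m≤o+n a (weight-mono w (drop-∷-⊆ X⊆Y))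
weight-mono (a ∷ w) {inside ∷ X}  {outside ∷ Y} X⊆Y with X⊆Y Vec.here
... | ()
weight-mono (a ∷ w) {inside ∷ X}  {inside ∷ Y}  X⊆Y = +-monoʳ-≤ a (weight-mono w (drop-∷-⊆ X⊆Y))

weight-∪-≤ : ∀ {n} (w : Vec ℕ n) {X Y Z} → X ⊆ Y ∪ Z → weight w X ≤ weight w Y + weight w Z
weight-∪-≤ w {X} {Y} {Z} X⊆ = begin
  weight w X                            ≤⟨ weight-mono w X⊆ ⟩
  weight w (Y ∪ Z)                      ≤⟨ m≤n+m _ _ ⟩
  weight w (Y ∩ Z) + weight w (Y ∪ Z)   ≡⟨ weight-modular w Y Z ⟩
  weight w Y + weight w Z               ∎
  where open ≤-Reasoning

lookup≤weight : ∀ {n} (w : Vec ℕ n) {X v} → v ∈ X → Vec.lookup w v ≤ weight w X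
lookup≤weight (a ∷ w) {inside ∷ X}  {zero}  Vec.here       = m≤m+n a _
lookup≤weight (a ∷ w) {inside ∷ X}  {suc v} (Vec.there v∈) = m≤n⇒m≤o+n a (lookup≤weight w v∈)
lookup≤weight (a ∷ w) {outside ∷ X} {suc v} (Vec.there v∈) = lookup≤weight w v∈

weight-⊥ : ∀ {n} (w : Vec ℕ n) → weight w ⊥ ≡ 0
weight-⊥ []      = refl
weight-⊥ (_ ∷ w) = weight-⊥ w

weight-⁅⁆ : ∀ {n} (w : Vec ℕ n) v → weight w ⁅ v ⁆ ≡ Vec.lookup w v
weight-⁅⁆ (a ∷ w) zero    = trans (cong (a +_) (weight-⊥ w)) (+-identityʳ a)
weight-⁅⁆ (a ∷ w) (suc v) = weight-⁅⁆ w v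

weight-decrement-∈ : ∀ {n} (w : Vec ℕ n) {X v} → v ∈ X → 1 ≤ Vec.lookup w v →
  weight w X ≡ suc (weight (updateAt w v pred) X)
weight-decrement-∈ (suc a ∷ w) {inside ∷ X}  {zero}  Vec.here       _ = refl
weight-decrement-∈ (a ∷ w)     {inside ∷ X}  {suc v} (Vec.there v∈) p =
  trans (cong (a +_) (weight-decrement-∈ w v∈ p)) (+-suc a _)
weight-decrement-∈ (a ∷ w)     {outside ∷ X} {suc v} (Vec.there v∈) p = weight-decrement-∈ w v∈ p

weight-decrement-∉ : ∀ {n} (w : Vec ℕ n) {X v} → v ∉ X →
  weight (updateAt w v pred) X ≡ weight w X
weight-decrement-∉ (a ∷ w) {inside ∷ X}  {zero}  v∉ = contradiction Vec.here v∉
weight-decrement-∉ (a ∷ w) {outside ∷ X} {zero}  v∉ = refl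
weight-decrement-∉ (a ∷ w) {inside ∷ X}  {suc v} v∉ =
  cong (a +_) (weight-decrement-∉ w (v∉ ∘ Vec.there))
weight-decrement-∉ (a ∷ w) {outside ∷ X} {suc v} v∉ = weight-decrement-∉ w (v∉ ∘ Vec.there)

weight-replicate-1 : ∀ {n} (X : Subset n) → weight (replicate n 1) X ≡ ∣ X ∣
weight-replicate-1 []            = refl
weight-replicate-1 (inside ∷ X)  = cong suc (weight-replicate-1 X)
weight-replicate-1 (outside ∷ X) = weight-replicate-1 X

∣∣-modular : ∀ {n} (X Y : Subset n) → ∣ X ∩ Y ∣ + ∣ X ∪ Y ∣ ≡ ∣ X ∣ + ∣ Y ∣
∣∣-modular X Y = begin
  ∣ X ∩ Y ∣ + ∣ X ∪ Y ∣                 ≡⟨ cong₂ _+_ (weight-replicate-1 (X ∩ Y)) (weight-replicate-1 (X ∪ Y)) ⟨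
  weight 𝟏 (X ∩ Y) + weight 𝟏 (X ∪ Y)   ≡⟨ weight-modular 𝟏 X Y ⟩
  weight 𝟏 X + weight 𝟏 Y               ≡⟨ cong₂ _+_ (weight-replicate-1 X) (weight-replicate-1 Y) ⟩
  ∣ X ∣ + ∣ Y ∣                         ∎
  where
  open ≡-Reasoning
  𝟏 = replicate _ 1

∣∣-uncross : ∀ {n} {A B C D : Subset n} → A ∩ B ⊆ C → A ∪ B ⊆ D →
  ∣ A ∣ + ∣ B ∣ ≤ ∣ C ∣ + ∣ D ∣
∣∣-uncross {A = A} {B} {C} {D} ∩⊆ ∪⊆ = begin
  ∣ A ∣ + ∣ B ∣           ≡⟨ ∣∣-modular A B ⟨
  ∣ A ∩ B ∣ + ∣ A ∪ B ∣   ≤⟨ +-mono-≤ (p⊆q⇒∣p∣≤∣q∣ ∩⊆) (p⊆q⇒∣p∣≤∣q∣ ∪⊆) ⟩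
  ∣ C ∣ + ∣ D ∣           ∎
  where open ≤-Reasoning

∣∣-∪-≤ : ∀ {n} {A B C : Subset n} → A ⊆ B ∪ C → ∣ A ∣ ≤ ∣ B ∣ + ∣ C ∣
∣∣-∪-≤ {A = A} {B} {C} A⊆ = begin
  ∣ A ∣                   ≤⟨ p⊆q⇒∣p∣≤∣q∣ A⊆ ⟩
  ∣ B ∪ C ∣               ≤⟨ m≤n+m _ _ ⟩
  ∣ B ∩ C ∣ + ∣ B ∪ C ∣   ≡⟨ ∣∣-modular B C ⟩
  ∣ B ∣ + ∣ C ∣           ∎
  where open ≤-Reasoning

∣∣-disjoint : ∀ {n} {A B D : Subset n} → A ⊆ D → B ⊆ D → Empty (A ∩ B) → ∣ A ∣ + ∣ B ∣ ≤ ∣ D ∣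
∣∣-disjoint {n} {A} {B} {D} A⊆D B⊆D A∩B=∅ = begin
  ∣ A ∣ + ∣ B ∣       ≤⟨ ∣∣-uncross {C = ⊥} {D} (λ x∈ → contradiction (_ , x∈) A∩B=∅)
                           ([ A⊆D , B⊆D ]′ ∘ x∈p∪q⁻ A B) ⟩
  ∣ ⊥ {n} ∣ + ∣ D ∣   ≡⟨ cong (_+ ∣ D ∣) (∣⊥∣≡0 n) ⟩
  ∣ D ∣               ∎
  where open ≤-Reasoning

-- Finite sums and double counting

sum-mono : ∀ {q} {f g : Fin q → ℕ} → (∀ i → f i ≤ g i) → sum f ≤ sum g
sum-mono {zero}  f≤g = z≤n
sum-mono {suc q} f≤g = +-mono-≤ (f≤g zero) (sum-mono (f≤g ∘ suc))

sum-+ : ∀ {q} (f g : Fin q → ℕ) → sum (λ i → f i + g i) ≡ sum f + sum g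
sum-+ = ∑-distrib-+

sum-const : ∀ q k → sum {q} (λ _ → k) ≡ k ℕ.* q
sum-const zero    k = sym (*-zeroʳ k)
sum-const (suc q) k = trans (cong (λ z → k + z) (sum-const q k)) (sym (*-suc k q))

∣∣-sum-disjoint : ∀ {q m} (A : Fin q → Subset m) {D} → (∀ i → A i ⊆ D) →
  (∀ {i j} → i ≢ j → Empty (A i ∩ A j)) → sum (λ i → ∣ A i ∣) ≤ ∣ D ∣
∣∣-sum-disjoint {zero}  A     A⊆D disj = z≤n
∣∣-sum-disjoint {suc q} A {D} A⊆D disj = begin
  ∣ A zero ∣ + sum (λ i → ∣ A (suc i) ∣)   ≤⟨ +-monoʳ-≤ ∣ A zero ∣ (∣∣-sum-disjoint (A ∘ suc)
      (λ i x∈ → x∈p∧x∉q⇒x∈p─q (A⊆D (suc i) x∈) λ x∈A₀ → disj {zero} {suc i} (λ ()) (_ , x∈p∩q⁺ (x∈A₀ , x∈)))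
      (λ i≢j → disj (i≢j ∘ sucᶠ-injective))) ⟩
  ∣ A zero ∣ + ∣ D ─ A zero ∣              ≤⟨ ∣∣-disjoint (A⊆D zero) (p─q⊆p D (A zero))
      (λ { (x , x∈) → let x∈A , x∈─ = x∈p∩q⁻ (A zero) _ x∈ in proj₂ (∈-─⁻ D (A zero) x∈─) x∈A }) ⟩
  ∣ D ∣                                    ∎
  where open ≤-Reasoning

weight-≤-sum : ∀ {q n} (w : Vec ℕ n) (A : Fin q → Subset n) {B} →
  (∀ {x} → x ∈ B → ∃[ i ] x ∈ A i) → weight w B ≤ sum (λ i → weight w (A i))
weight-≤-sum {zero} w A {B} cov = subst (weight w B ≤_) (weight-⊥ w) (weight-mono w λ x∈ → nope (cov x∈))
  where
  nope : ∀ {x} → ∃[ i ] x ∈ A i → x ∈ ⊥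
  nope ()
weight-≤-sum {suc q} w A {B} cov =
  ≤-trans (weight-∪-≤ w split) (+-monoʳ-≤ _ (weight-≤-sum w (A ∘ suc) rest))
  where
  split : B ⊆ A zero ∪ (B ─ A zero)
  split {x} x∈ with x ∈? A zero
  ... | yes x∈A = x∈p∪q⁺ (inj₁ x∈A)
  ... | no  x∉A = x∈p∪q⁺ (inj₂ (x∈p∧x∉q⇒x∈p─q x∈ x∉A))
  rest : ∀ {x} → x ∈ B ─ A zero → ∃[ i ] x ∈ A (suc i)
  rest x∈ with ∈-─⁻ B (A zero) x∈
  ... | x∈B , x∉A with cov x∈B
  ... | zero  , x∈A = contradiction x∈A x∉A
  ... | suc i , x∈A = i , x∈A

indicator : Bool → ℕ
indicator true  = 1
indicator false = 0

∣tabulate∣ : ∀ {n} (f : Fin n → Bool) → ∣ Vec.tabulate f ∣ ≡ sum (indicator ∘ f)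
∣tabulate∣ {zero}  f = refl
∣tabulate∣ {suc n} f with f zero
... | true  = cong suc (∣tabulate∣ (f ∘ suc))
... | false = ∣tabulate∣ (f ∘ suc)

double-counting : ∀ {a b} {P : Fin a → Fin b → Set} (P? : ∀ x y → Dec (P x y)) →
  sum (λ x → ∣ setOf (P? x) ∣) ≡ sum (λ y → ∣ setOf (λ x → P? x y) ∣)
double-counting P? = begin
  sum (λ x → ∣ setOf (P? x) ∣)                      ≡⟨ sum-cong-≗ (λ x → ∣tabulate∣ (does ∘ P? x)) ⟩
  sum (λ x → sum (λ y → indicator (does (P? x y)))) ≡⟨ ∑-comm (λ x y → indicator (does (P? x y))) ⟩
  sum (λ y → sum (λ x → indicator (does (P? x y)))) ≡⟨ sum-cong-≗ (λ y → ∣tabulate∣ (λ x → does (P? x y))) ⟨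
  sum (λ y → ∣ setOf (λ x → P? x y) ∣)              ∎
  where open ≡-Reasoning

-- Matroid rank

-- `rank` is a maximum over the list `subsets t`; completeness of the list turns it into a maximum
-- over all independent subsets.
subsets-complete : ∀ {n} (X : Subset n) → X ∈ᴸ subsets n
subsets-complete []            = here refl
subsets-complete (inside ∷ X)  = ∈-++⁺ˡ (∈-map⁺ _ (subsets-complete X))
subsets-complete (outside ∷ X) = ∈-++⁺ʳ _ (∈-map⁺ _ (subsets-complete X))

∪-least : ∀ {n} {A B C : Subset n} → A ⊆ C → B ⊆ C → A ∪ B ⊆ C
∪-least {A = A} {B} A⊆C B⊆C = [ A⊆C , B⊆C ]′ ∘ x∈p∪q⁻ A B

⁅⁆⊆ : ∀ {n} {x : Fin n} {A} → x ∈ A → ⁅ x ⁆ ⊆ A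
⁅⁆⊆ {x = x} {A} x∈A y∈ = subst (_∈ A) (sym (x∈⁅y⁆⇒x≡y x y∈)) x∈A

∈-insert : ∀ {n} (A : Subset n) {s} → s ∈ A ∪ ⁅ s ⁆
∈-insert A {s} = x∈p∪q⁺ (inj₂ (x∈⁅x⁆ s))

insert-mono : ∀ {n} {A B : Subset n} {s} → A ⊆ B → A ∪ ⁅ s ⁆ ⊆ B ∪ ⁅ s ⁆
insert-mono {B = B} A⊆B = ∪-least (p⊆p∪q _ ∘ A⊆B) (⁅⁆⊆ (∈-insert B))

∣p∣≤1+∣p-x∣ : ∀ {n} (p : Subset n) x → ∣ p ∣ ≤ suc ∣ p -ˢ x ∣
∣p∣≤1+∣p-x∣ p x = begin
  ∣ p ∣                    ≤⟨ ∣∣-∪-≤ p⊆ ⟩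
  ∣ ⁅ x ⁆ ∣ + ∣ p -ˢ x ∣   ≡⟨ cong (_+ ∣ p -ˢ x ∣) (∣⁅x⁆∣≡1 x) ⟩
  suc ∣ p -ˢ x ∣           ∎
  where
  open ≤-Reasoning
  p⊆ : p ⊆ ⁅ x ⁆ ∪ (p -ˢ x)
  p⊆ {y} y∈p with y ≟ᶠ x
  ... | yes refl = p⊆p∪q (p -ˢ x) (x∈⁅x⁆ x)
  ... | no y≢x   = q⊆p∪q _ _ (x∈p∧x≢y⇒x∈p-y y∈p y≢x)

module Rank {t} (M : Matroid t) where
  open Matroid M

  private
    independentIn? : ∀ X → Decidable (λ I → Indep I × I ⊆ X)
    independentIn? X I = indep? I ×-dec (I ⊆? X)

  rank-upper : ∀ {I X} → Indep I → I ⊆ X → ∣ I ∣ ≤ rank X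
  rank-upper {I} {X} indI I⊆X = All.lookup (xs≤max 0 _)
    (∈-map⁺ ∣_∣ (∈-filter⁺ (independentIn? X) (subsets-complete I) (indI , I⊆X)))

  rank-attained : ∀ X → ∃[ I ] Indep I × I ⊆ X × ∣ I ∣ ≡ rank X
  rank-attained X with argmax-sel (λ a → a) 0 (Data.List.map ∣_∣ (Data.List.filter (independentIn? X) (subsets t)))
  -- The maximum is the default value 0 of `max`, which the empty set attains.
  ... | inj₁ rank≡0 = ⊥ , indep-⊥ , ⊆-min X , trans (∣⊥∣≡0 t) (sym rank≡0)
  ... | inj₂ rank∈ with ∈-map⁻ ∣_∣ rank∈
  ... | I , I∈ , rank≡ with ∈-filter⁻ (independentIn? X) {xs = subsets t} I∈
  ... | _ , indI , I⊆X = I , indI , I⊆X , sym rank≡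

  -- As long as I is smaller than a maximum independent subset B of X, augmentation supplies an
  -- element of B to add. The fuel bounds the number of elements still missing.
  extend-to-basis : ∀ {I X} → Indep I → I ⊆ X → ∃[ J ] Indep J × I ⊆ J × J ⊆ X × ∣ J ∣ ≡ rank X
  extend-to-basis {I} {X} indI I⊆X = go (rank X ∸ ∣ I ∣) indI I⊆X ≤-refl
    where
    go : ∀ fuel {I} → Indep I → I ⊆ X → rank X ∸ ∣ I ∣ ≤ fuel →
         ∃[ J ] Indep J × I ⊆ J × J ⊆ X × ∣ J ∣ ≡ rank X
    go fuel {I} indI I⊆X bound with m≤n⇒m<n∨m≡n (rank-upper indI I⊆X)
    ... | inj₂ eq = I , indI , ⊆-refl , I⊆X , eq
    ... | inj₁ lt with rank-attained X
    ... | B , indB , B⊆X , ∣B∣≡ with augmentation indI indB (subst (∣ I ∣ <_) (sym ∣B∣≡) lt)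
    go zero       indI I⊆X bound | inj₁ lt | _ | _ = contradiction (m∸n≡0⇒m≤n (n≤0⇒n≡0 bound)) (<⇒≱ lt)
    go (suc fuel) {I} indI I⊆X bound | inj₁ lt | B , indB , B⊆X , ∣B∣≡ | e , e∈B , e∉I , indI+e
      with go fuel indI+e (∪-least I⊆X (⁅⁆⊆ (B⊆X e∈B)))
             (s≤s⁻¹ (≤-trans (∸-monoʳ-< ∣I∣<∣I+e∣ (rank-upper indI+e (∪-least I⊆X (⁅⁆⊆ (B⊆X e∈B))))) bound))
      where
      ∣I∣<∣I+e∣ : ∣ I ∣ < ∣ I ∪ ⁅ e ⁆ ∣
      ∣I∣<∣I+e∣ = p⊂q⇒∣p∣<∣q∣ (p⊆p∪q _ , e , ∈-insert I , e∉I)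
    ... | J , indJ , I+e⊆J , J⊆X , ∣J∣≡ = J , indJ , I+e⊆J ∘ p⊆p∪q _ , J⊆X , ∣J∣≡

  rank-mono : ∀ {A B} → A ⊆ B → rank A ≤ rank B
  rank-mono {A} A⊆B with rank-attained A
  ... | I , indI , I⊆A , ∣I∣≡ = subst (_≤ _) ∣I∣≡ (rank-upper indI (⊆-trans I⊆A A⊆B))

  rank≤∣∣ : ∀ A → rank A ≤ ∣ A ∣
  rank≤∣∣ A with rank-attained A
  ... | I , _ , I⊆A , ∣I∣≡ = subst (_≤ _) ∣I∣≡ (p⊆q⇒∣p∣≤∣q∣ I⊆A)

  -- Extend a basis I of C to a basis J of A ∪ B. Then J ∩ A and J ∩ B are independent, cover J, and
  -- both contain I, so their sizes add up to at least ∣ I ∣ + ∣ J ∣. Inclusions replace the exact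
  -- intersection and union because the roots joined over X ∩ Y may be fewer than those common to X
  -- and Y.
  rank-submodular : ∀ {A B C D} → C ⊆ A → C ⊆ B → D ⊆ A ∪ B → rank C + rank D ≤ rank A + rank B
  rank-submodular {A} {B} {C} {D} C⊆A C⊆B D⊆A∪B with rank-attained C
  ... | I , indI , I⊆C , ∣I∣≡ with extend-to-basis {X = A ∪ B} indI (p⊆p∪q _ ∘ C⊆A ∘ I⊆C)
  ... | J , indJ , I⊆J , J⊆ , ∣J∣≡ = begin
    rank C + rank D             ≤⟨ +-monoʳ-≤ (rank C) (rank-mono D⊆A∪B) ⟩
    rank C + rank (A ∪ B)       ≡⟨ cong₂ _+_ ∣I∣≡ ∣J∣≡ ⟨
    ∣ I ∣ + ∣ J ∣               ≤⟨ +-mono-≤ (p⊆q⇒∣p∣≤∣q∣ I⊆) (p⊆q⇒∣p∣≤∣q∣ J⊆∪) ⟩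
    ∣ (J ∩ A) ∩ (J ∩ B) ∣ + ∣ (J ∩ A) ∪ (J ∩ B) ∣
                                ≡⟨ ∣∣-modular (J ∩ A) (J ∩ B) ⟩
    ∣ J ∩ A ∣ + ∣ J ∩ B ∣       ≤⟨ +-mono-≤ (rank-upper (indep-⊆ (p∩q⊆p J A) indJ) (p∩q⊆q J A))
                                            (rank-upper (indep-⊆ (p∩q⊆p J B) indJ) (p∩q⊆q J B)) ⟩
    rank A + rank B             ∎
    where
    open ≤-Reasoning
    I⊆ : I ⊆ (J ∩ A) ∩ (J ∩ B)
    I⊆ x∈ = x∈p∩q⁺ (x∈p∩q⁺ (I⊆J x∈ , C⊆A (I⊆C x∈)) , x∈p∩q⁺ (I⊆J x∈ , C⊆B (I⊆C x∈)))
    J⊆∪ : J ⊆ (J ∩ A) ∪ (J ∩ B)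
    J⊆∪ x∈ with x∈p∪q⁻ A B (J⊆ x∈)
    ... | inj₁ x∈A = x∈p∪q⁺ (inj₁ (x∈p∩q⁺ (x∈ , x∈A)))
    ... | inj₂ x∈B = x∈p∪q⁺ (inj₂ (x∈p∩q⁺ (x∈ , x∈B)))

  rank-∪-≤ : ∀ {A B D} → D ⊆ A ∪ B → rank D ≤ rank A + rank B
  rank-∪-≤ D⊆ = ≤-trans (m≤n+m _ _) (rank-submodular (⊆-min _) (⊆-min _) D⊆)

-- Uncrossing

Disjoint : ∀ {n} → Subset n → Subset n → Set
Disjoint A B = Empty (A ∩ B)

disjoint-sym : ∀ {n} {A B : Subset n} → Disjoint A B → Disjoint B A
disjoint-sym {A = A} {B} dis (x , x∈) with x∈p∩q⁻ B A x∈
... | x∈B , x∈A = dis (x , x∈p∩q⁺ (x∈A , x∈B))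

disjoint-∪ : ∀ {n} {A B C : Subset n} → Disjoint A B → Disjoint A C → Disjoint A (B ∪ C)
disjoint-∪ {A = A} {B} {C} disB disC (x , x∈) with x∈p∩q⁻ A (B ∪ C) x∈
... | x∈A , x∈∪ with x∈p∪q⁻ B C x∈∪
... | inj₁ x∈B = disB (x , x∈p∩q⁺ (x∈A , x∈B))
... | inj₂ x∈C = disC (x , x∈p∩q⁺ (x∈A , x∈C))

merge : ∀ {n} → Subset n → List (Subset n) → List (Subset n)
merge T []      = T ∷ []
merge T (X ∷ L) with nonempty? (T ∩ X)
... | yes _ = merge (T ∪ X) L
... | no  _ = X ∷ merge T L

merge-∋ : ∀ {n} (T : Subset n) L {v} → v ∈ T ⊎ Any (v ∈_) L → Any (v ∈_) (merge T L)
merge-∋ T []      (inj₁ v∈T) = here v∈T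
merge-∋ T (X ∷ L) v∈ with nonempty? (T ∩ X)
merge-∋ T (X ∷ L) (inj₁ v∈T)         | yes _ = merge-∋ (T ∪ X) L (inj₁ (p⊆p∪q X v∈T))
merge-∋ T (X ∷ L) (inj₂ (here v∈X))  | yes _ = merge-∋ (T ∪ X) L (inj₁ (q⊆p∪q T X v∈X))
merge-∋ T (X ∷ L) (inj₂ (there v∈L)) | yes _ = merge-∋ (T ∪ X) L (inj₂ v∈L)
merge-∋ T (X ∷ L) (inj₁ v∈T)         | no  _ = there (merge-∋ T L (inj₁ v∈T))
merge-∋ T (X ∷ L) (inj₂ (here v∈X))  | no  _ = here v∈X
merge-∋ T (X ∷ L) (inj₂ (there v∈L)) | no  _ = there (merge-∋ T L (inj₂ v∈L))

merge-disjointFrom : ∀ {n} {A} (T : Subset n) L →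
  Disjoint A T → All (Disjoint A) L → All (Disjoint A) (merge T L)
merge-disjointFrom T []      disT []             = disT ∷ []
merge-disjointFrom T (X ∷ L) disT (disX ∷ disL) with nonempty? (T ∩ X)
... | yes _ = merge-disjointFrom (T ∪ X) L (disjoint-∪ disT disX) disL
... | no  _ = disX ∷ merge-disjointFrom T L disT disL

-- One pass over the list suffices. A set X left in place stays disjoint from the merged set,
-- because T grows afterwards only by later members of the list, and those are disjoint from X.
merge-disjoint : ∀ {n} (T : Subset n) {L} → AllPairs Disjoint L → AllPairs Disjoint (merge T L)
merge-disjoint T {[]}    []            = [] ∷ []
merge-disjoint T {X ∷ L} (disX ∷ disL) with nonempty? (T ∩ X)
... | yes _   = merge-disjoint (T ∪ X) disL
... | no  dis = merge-disjointFrom T L (disjoint-sym {A = T} dis) disX ∷ merge-disjoint T disL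

merge-All : ∀ {n} {Q : Pred (Subset n) 0ℓ} →
  (∀ {X Y} → Nonempty (X ∩ Y) → Q X → Q Y → Q (X ∪ Y)) →
  ∀ {T L} → Q T → All Q L → All Q (merge T L)
merge-All ∪-closed {T} {[]}    qT []        = qT ∷ []
merge-All ∪-closed {T} {X ∷ L} qT (qX ∷ qL) with nonempty? (T ∩ X)
... | yes ne = merge-All ∪-closed (∪-closed ne qT qX) qL
... | no  _  = qX ∷ merge-All ∪-closed qT qL

disjoint-lookup : ∀ {n} {L : List (Subset n)} → AllPairs Disjoint L →
  ∀ {i j} → i ≢ j → Disjoint (lookup L i) (lookup L j)
disjoint-lookup (dis ∷ _)  {zero}  {zero}  i≢j = contradiction refl i≢j
disjoint-lookup {L = X ∷ L} (dis ∷ _)  {zero}  {suc j} i≢j = All.lookup dis (∈-lookup j)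
disjoint-lookup {L = X ∷ L} (dis ∷ _)  {suc i} {zero}  i≢j =
  disjoint-sym {A = X} (All.lookup dis (∈-lookup i))
disjoint-lookup (_ ∷ dis)  {suc i} {suc j} i≢j = disjoint-lookup dis (i≢j ∘ cong suc)

-- Insert a covering set for each vertex in turn with `merge`. Sets that overlap are united, which
-- preserves Q, so the final list is pairwise disjoint and still covers every vertex.
partition-within : ∀ {n} (Q : Pred (Subset n) 0ℓ) →
  (∀ {X Y} → Nonempty (X ∩ Y) → Q X → Q Y → Q (X ∪ Y)) →
  (∀ v → ∃[ X ] v ∈ X × Q X) →
  ∃[ P ] (∀ i → Q (Partition.part P i))
partition-within {n} Q ∪-closed cover = record
  { size     = length L
  ; part     = lookup L
  ; nonempty = λ i → proj₁ (All.lookup allQ (∈-lookup i))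
  ; disjoint = disjoint-lookup dis
  ; covers   = λ v → let v∈L = covered (∈-allFin v) in Any.index v∈L , lookup-index v∈L
  } , λ i → proj₂ (All.lookup allQ (∈-lookup i))
  where
  -- The parts of a `Partition` must be nonempty, so nonemptiness is carried along with Q.
  Q⁺ : Pred (Subset n) 0ℓ
  Q⁺ X = Nonempty X × Q X

  Q⁺-∪-closed : ∀ {X Y} → Nonempty (X ∩ Y) → Q⁺ X → Q⁺ Y → Q⁺ (X ∪ Y)
  Q⁺-∪-closed {Y = Y} ne ((x , x∈) , qX) (_ , qY) = (x , p⊆p∪q Y x∈) , ∪-closed ne qX qY

  family : (vs : List (Fin n)) →
    ∃[ L ] All Q⁺ L × AllPairs Disjoint L × (∀ {v} → v ∈ᴸ vs → Any (v ∈_) L)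
  family []       = [] , [] , [] , λ ()
  family (v ∷ vs) with family vs | cover v
  ... | L , allQ , dis , covered | X , v∈X , qX =
    merge X L , merge-All Q⁺-∪-closed ((v , v∈X) , qX) allQ , merge-disjoint X dis ,
    λ { (here refl) → merge-∋ X L (inj₁ v∈X) ; (there u∈) → merge-∋ X L (inj₂ (covered u∈)) }

  L       = proj₁ (family (allFin n))
  allQ    = proj₁ (proj₂ (family (allFin n)))
  dis     = proj₁ (proj₂ (proj₂ (family (allFin n))))
  covered = proj₂ (proj₂ (proj₂ (family (allFin n))))

weight-disjoint : ∀ {n} (w : Vec ℕ n) {X Y Z} → X ⊆ Z → Y ⊆ Z → Disjoint X Y →
  weight w X + weight w Y ≤ weight w Z
weight-disjoint w {X} {Y} {Z} X⊆Z Y⊆Z dis = begin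
  weight w X + weight w Y               ≡⟨ weight-modular w X Y ⟨
  weight w (X ∩ Y) + weight w (X ∪ Y)   ≤⟨ +-mono-≤ (weight-mono w {Y = ⊥} λ x∈ → contradiction (_ , x∈) dis)
                                                    (weight-mono w (∪-least X⊆Z Y⊆Z)) ⟩
  weight w ⊥ + weight w Z               ≡⟨ cong (_+ weight w Z) (weight-⊥ w) ⟩
  weight w Z                            ∎
  where open ≤-Reasoning

-- Demands and tight sets

module Demands {n m t} (G : Graph n m) (M : Matroid t) where
  open Graph G
  open Matroid M using (rank)
  open Rank M

  k : ℕ
  k = rank ⊤

  rank≤k : ∀ A → rank A ≤ k
  rank≤k A = rank-mono (⊆-max A)

  joined : (Fin n → Subset t) → Subset n → Subset t
  joined S X = setOf λ s → any? λ v → (v ∈? X) ×-dec (s ∈? S v)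

  induced : Subset m → Subset n → Subset m
  induced E X = setOf λ e → (e ∈? E) ×-dec (proj₁ (ends e) ∈? X) ×-dec (proj₂ (ends e) ∈? X)

  module _ {S : Fin n → Subset t} where

    ∈-joined⁺ : ∀ {X v s} → v ∈ X → s ∈ S v → s ∈ joined S X
    ∈-joined⁺ {X} v∈X s∈ = ∈-setOf⁺ (λ s → any? λ v → (v ∈? X) ×-dec (s ∈? S v)) (_ , v∈X , s∈)

    ∈-joined⁻ : ∀ {X s} → s ∈ joined S X → ∃[ v ] v ∈ X × s ∈ S v
    ∈-joined⁻ {X} = ∈-setOf⁻ (λ s → any? λ v → (v ∈? X) ×-dec (s ∈? S v))

    joined-mono : ∀ {X Y} → X ⊆ Y → joined S X ⊆ joined S Y
    joined-mono X⊆Y s∈ with ∈-joined⁻ s∈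
    ... | v , v∈X , s∈S = ∈-joined⁺ (X⊆Y v∈X) s∈S

    joined-∪ : ∀ X Y → joined S (X ∪ Y) ⊆ joined S X ∪ joined S Y
    joined-∪ X Y s∈ with ∈-joined⁻ s∈
    ... | v , v∈ , s∈S with x∈p∪q⁻ X Y v∈
    ... | inj₁ v∈X = x∈p∪q⁺ (inj₁ (∈-joined⁺ v∈X s∈S))
    ... | inj₂ v∈Y = x∈p∪q⁺ (inj₂ (∈-joined⁺ v∈Y s∈S))

  module _ {E : Subset m} where

    ∈-induced⁺ : ∀ {X e} → e ∈ E → proj₁ (ends e) ∈ X → proj₂ (ends e) ∈ X → e ∈ induced E X
    ∈-induced⁺ {X} e∈E p∈ q∈ =
      ∈-setOf⁺ (λ e → (e ∈? E) ×-dec (proj₁ (ends e) ∈? X) ×-dec (proj₂ (ends e) ∈? X)) (e∈E , p∈ , q∈)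

    ∈-induced⁻ : ∀ {X e} → e ∈ induced E X → e ∈ E × proj₁ (ends e) ∈ X × proj₂ (ends e) ∈ X
    ∈-induced⁻ {X} = ∈-setOf⁻ (λ e → (e ∈? E) ×-dec (proj₁ (ends e) ∈? X) ×-dec (proj₂ (ends e) ∈? X))

    induced-mono : ∀ {X Y} → X ⊆ Y → induced E X ⊆ induced E Y
    induced-mono X⊆Y e∈ with ∈-induced⁻ e∈
    ... | e∈E , p∈ , q∈ = ∈-induced⁺ e∈E (X⊆Y p∈) (X⊆Y q∈)

    -- An edge inside both sets lies inside X ∩ Y, and an edge inside either lies inside X ∪ Y.
    -- Equality can fail because of edges between X - Y and Y - X.
    induced-supermodular : ∀ X Y →
      ∣ induced E X ∣ + ∣ induced E Y ∣ ≤ ∣ induced E (X ∩ Y) ∣ + ∣ induced E (X ∪ Y) ∣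
    induced-supermodular X Y =
      ∣∣-uncross ∩⊆ (∪-least (induced-mono (p⊆p∪q Y)) (induced-mono (q⊆p∪q X Y)))
      where
      ∩⊆ : induced E X ∩ induced E Y ⊆ induced E (X ∩ Y)
      ∩⊆ e∈ with x∈p∩q⁻ (induced E X) _ e∈
      ... | e∈X , e∈Y with ∈-induced⁻ e∈X | ∈-induced⁻ e∈Y
      ... | e∈E , p∈X , q∈X | _ , p∈Y , q∈Y = ∈-induced⁺ e∈E (x∈p∩q⁺ (p∈X , p∈Y)) (x∈p∩q⁺ (q∈X , q∈Y))

  -- This is w(X) + f(X) ≥ i(X) + k, with f(X) = `rank (joined S X)` and i(X) = `∣ induced E X ∣`.
  -- Only nonempty X are considered, since for the empty set the inequality would say k ≤ 0.
  Covers : Subset m → (Fin n → Subset t) → Vec ℕ n → Set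
  Covers E S w = ∀ {X} → Nonempty X → ∣ induced E X ∣ + k ≤ weight w X + rank (joined S X)

  -- For A = ⊥ this is equality in Covers; for A = ⁅ s ⁆ it says moreover that
  -- s lies in the span of the roots in X.
  Tight : Subset m → (Fin n → Subset t) → Vec ℕ n → Subset t → Subset n → Set
  Tight E S w A X = weight w X + rank (joined S X ∪ A) ≤ ∣ induced E X ∣ + k

  module _ {E S w} (covers : Covers E S w) where

    Covers⇒≤ : ∀ A {X} → Nonempty X → ∣ induced E X ∣ + k ≤ weight w X + rank (joined S X ∪ A)
    Covers⇒≤ A ne = ≤-trans (covers ne) (+-monoʳ-≤ _ (rank-mono (p⊆p∪q A)))

    module _ {A X Y} (ne : Nonempty (X ∩ Y)) (tightX : Tight E S w A X) (tightY : Tight E S w A Y) where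

      private
        demand : Subset n → ℕ
        demand Z = weight w Z + rank (joined S Z ∪ A)

        supply : Subset n → ℕ
        supply Z = ∣ induced E Z ∣ + k

        ∪⊆ : joined S (X ∪ Y) ∪ A ⊆ (joined S X ∪ A) ∪ (joined S Y ∪ A)
        ∪⊆ = ∪-least (∪-least (p⊆p∪q _ ∘ p⊆p∪q A) (q⊆p∪q _ _ ∘ p⊆p∪q A) ∘ joined-∪ X Y)
                     (p⊆p∪q _ ∘ q⊆p∪q _ A)

        ∩⊆ : ∀ {Z} → X ∩ Y ⊆ Z → joined S (X ∩ Y) ∪ A ⊆ joined S Z ∪ A
        ∩⊆ X∩Y⊆Z = ∪-least (p⊆p∪q A ∘ joined-mono X∩Y⊆Z) (q⊆p∪q _ A)

        -- The weight is modular, the rank submodular and the number of induced edges supermodular.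
        -- Adding the same A to every root set keeps the inclusions that `rank-submodular` asks for.
        uncrossed : demand (X ∩ Y) + demand (X ∪ Y) ≤ supply (X ∩ Y) + supply (X ∪ Y)
        uncrossed = begin
          demand (X ∩ Y) + demand (X ∪ Y)
            ≡⟨ interchange (weight w (X ∩ Y)) _ _ _ ⟩
          (weight w (X ∩ Y) + weight w (X ∪ Y)) + (rank (joined S (X ∩ Y) ∪ A) + rank (joined S (X ∪ Y) ∪ A))
            ≤⟨ +-mono-≤ (≤-reflexive (weight-modular w X Y))
                        (rank-submodular (∩⊆ (p∩q⊆p X Y)) (∩⊆ (p∩q⊆q X Y)) ∪⊆) ⟩
          (weight w X + weight w Y) + (rank (joined S X ∪ A) + rank (joined S Y ∪ A))
            ≡⟨ interchange (weight w X) _ _ _ ⟩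
          demand X + demand Y
            ≤⟨ +-mono-≤ tightX tightY ⟩
          supply X + supply Y
            ≡⟨ interchange ∣ induced E X ∣ k _ k ⟩
          (∣ induced E X ∣ + ∣ induced E Y ∣) + (k + k)
            ≤⟨ +-monoˡ-≤ (k + k) (induced-supermodular X Y) ⟩
          (∣ induced E (X ∩ Y) ∣ + ∣ induced E (X ∪ Y) ∣) + (k + k)
            ≡⟨ interchange ∣ induced E (X ∩ Y) ∣ _ k k ⟩
          supply (X ∩ Y) + supply (X ∪ Y) ∎
          where open ≤-Reasoning

      -- `Covers` gives supply ≤ demand at X ∩ Y and at X ∪ Y, while `uncrossed` bounds the sum of
      -- the two demands by the sum of the supplies. Cancelling one set against its own `Covers`
      -- inequality leaves tightness of the other. X ∩ Y must be nonempty for `Covers` to apply to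
      -- it.
      tight-∩ : Tight E S w A (X ∩ Y)
      tight-∩ = +-cancelʳ-≤ (demand (X ∪ Y)) _ _
        (≤-trans uncrossed (+-monoʳ-≤ (supply (X ∩ Y)) (Covers⇒≤ A (proj₁ ne , p⊆p∪q Y (p∩q⊆p X Y (proj₂ ne))))))

      tight-∪ : Tight E S w A (X ∪ Y)
      tight-∪ = +-cancelˡ-≤ (demand (X ∩ Y)) _ _
        (≤-trans uncrossed (+-monoˡ-≤ (supply (X ∪ Y)) (Covers⇒≤ A ne)))

  tight? : ∀ E S w A → Decidable (Tight E S w A)
  tight? E S w A X = _ ≤? _

-- Crossing edges of a partition

part-unique : ∀ {n} (P : Partition n) {v i j} →
  v ∈ Partition.part P i → v ∈ Partition.part P j → i ≡ j
part-unique P {v} {i} {j} v∈i v∈j = decidable-stable (i ≟ᶠ j)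
  λ i≢j → Partition.disjoint P i≢j (v , x∈p∩q⁺ (v∈i , v∈j))

module _ {n m} (G : Graph n m) (P : Partition n) where
  open Graph G
  open Partition P using (part)

  private
    crosses? : ∀ e → Dec (∃[ i ] ∃[ j ] i ≢ j × proj₁ (ends e) ∈ part i × proj₂ (ends e) ∈ part j)
    crosses? e = any? λ i → any? λ j →
      ¬? (i ≟ᶠ j) ×-dec (proj₁ (ends e) ∈? part i) ×-dec (proj₂ (ends e) ∈? part j)

  ∈-δ⁺ : ∀ {e i j} → i ≢ j → proj₁ (ends e) ∈ part i → proj₂ (ends e) ∈ part j → e ∈ δ G P
  ∈-δ⁺ i≢j p∈ q∈ = ∈-setOf⁺ crosses? (_ , _ , i≢j , p∈ , q∈)

  ∈-δ⁻ : ∀ {e} → e ∈ δ G P →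
    ∃[ i ] ∃[ j ] i ≢ j × proj₁ (ends e) ∈ part i × proj₂ (ends e) ∈ part j
  ∈-δ⁻ = ∈-setOf⁻ crosses?

-- Existence of an initial demand

module Demands-existence {n m t} (G : Graph n m) (M : Matroid t) (S : Fin n → Subset t) where
  open Graph G
  open Matroid M using (rank)
  open Rank M
  open Demands G M
  open Partition

  PartitionCondition : Set
  PartitionCondition = ∀ P → k ℕ.* size P ≤ ∣ δ G P ∣ + sum (λ i → rank (joined S (part P i)))

  -- An edge inside a part determines that part and does not cross, so the sets being counted are
  -- pairwise disjoint.
  inner+crossing≤ : ∀ P → sum (λ i → ∣ induced ⊤ (part P i) ∣) + ∣ δ G P ∣ ≤ m
  inner+crossing≤ P = begin
    sum (λ i → ∣ induced ⊤ (part P i) ∣) + ∣ δ G P ∣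
      ≤⟨ +-monoˡ-≤ ∣ δ G P ∣ (∣∣-sum-disjoint (λ i → induced ⊤ (part P i)) inner pairwise) ⟩
    ∣ ⊤ ─ δ G P ∣ + ∣ δ G P ∣
      ≤⟨ ∣∣-disjoint ⊆⊤ ⊆⊤ (λ { (e , e∈) → let e∈─ , e∈δ = x∈p∩q⁻ (⊤ ─ δ G P) _ e∈ in
                                            proj₂ (∈-─⁻ ⊤ (δ G P) e∈─) e∈δ }) ⟩
    ∣ ⊤ {m} ∣
      ≡⟨ ∣⊤∣≡n m ⟩
    m ∎
    where
    open ≤-Reasoning
    inner : ∀ i → induced ⊤ (part P i) ⊆ ⊤ ─ δ G P
    inner i e∈ = x∈p∧x∉q⇒x∈p─q ∈⊤ λ e∈δ →
      let _ , p∈ , q∈ = ∈-induced⁻ e∈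
          a , b , a≢b , p∈a , q∈b = ∈-δ⁻ G P e∈δ
      in a≢b (trans (part-unique P p∈a p∈) (part-unique P q∈ q∈b))
    pairwise : ∀ {i j} → i ≢ j → Disjoint (induced ⊤ (part P i)) (induced ⊤ (part P j))
    pairwise {i} {j} i≢j (e , e∈) =
      let e∈i , e∈j = x∈p∩q⁻ (induced ⊤ (part P i)) _ e∈
      in i≢j (part-unique P (proj₁ (proj₂ (∈-induced⁻ e∈i))) (proj₁ (proj₂ (∈-induced⁻ e∈j))))

  module _ (condition : PartitionCondition) where

    -- Summing tightness over the parts yields k times the number of parts on the right. The
    -- partition condition replaces this by ∣ δ ∣ + Σ f, and Σ f cancels. What remains counts inner
    -- and crossing edges, at most m in all.
    tight-partition : ∀ w P → (∀ i → Tight ⊤ S w ⊥ (part P i)) → weight w ⊤ ≤ m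
    tight-partition w P tight = ≤-trans (+-cancelʳ-≤ (sum f) _ _ total) (inner+crossing≤ P)
      where
      open ≤-Reasoning
      f inner : Fin (size P) → ℕ
      f i = rank (joined S (part P i))
      inner i = ∣ induced ⊤ (part P i) ∣
      total : weight w ⊤ + sum f ≤ (sum inner + ∣ δ G P ∣) + sum f
      total = begin
        weight w ⊤ + sum f
          ≤⟨ +-monoˡ-≤ (sum f) (weight-≤-sum w (part P) λ {v} _ → covers P v) ⟩
        sum (λ i → weight w (part P i)) + sum f
          ≡⟨ sum-+ _ f ⟨
        sum (λ i → weight w (part P i) + f i)
          ≤⟨ sum-mono (λ i → ≤-trans (+-monoʳ-≤ (weight w (part P i)) (rank-mono (p⊆p∪q ⊥))) (tight i)) ⟩
        sum (λ i → inner i + k)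
          ≡⟨ sum-+ inner _ ⟩
        sum inner + sum (λ (i : Fin (size P)) → k)
          ≡⟨ cong (sum inner +_) (sum-const (size P) k) ⟩
        sum inner + k ℕ.* size P
          ≤⟨ +-monoʳ-≤ (sum inner) (condition P) ⟩
        sum inner + (∣ δ G P ∣ + sum f)
          ≡⟨ +-assoc (sum inner) _ _ ⟨
        (sum inner + ∣ δ G P ∣) + sum f ∎

    InTight : Vec ℕ n → Fin n → Set
    InTight w v = ∃[ X ] v ∈ X × Tight ⊤ S w ⊥ X

    inTight? : ∀ w → Decidable (InTight w)
    inTight? w v = anySubset? λ X → (v ∈? X) ×-dec tight? ⊤ S w ⊥ X

    -- If v had weight 0, the singleton of v would be tight, because no rank exceeds k.
    loose⇒positive : ∀ w {v} → ¬ InTight w v → 1 ≤ Vec.lookup w v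
    loose⇒positive w {v} loose = n≢0⇒n>0 λ w[v]≡0 → loose (⁅ v ⁆ , x∈⁅x⁆ v , (begin
      weight w ⁅ v ⁆ + rank (joined S ⁅ v ⁆ ∪ ⊥)   ≡⟨ cong (_+ rank (joined S ⁅ v ⁆ ∪ ⊥)) (trans (weight-⁅⁆ w v) w[v]≡0) ⟩
      rank (joined S ⁅ v ⁆ ∪ ⊥)                    ≤⟨ rank≤k _ ⟩
      k                                            ≤⟨ m≤n+m k _ ⟩
      ∣ induced ⊤ ⁅ v ⁆ ∣ + k                      ∎))
      where open ≤-Reasoning

    -- Sets avoiding v keep their weight. Sets containing v are not tight, hence have slack at least
    -- one to pay for the decrement.
    loose-decrement : ∀ w {v} → ¬ InTight w v → Covers ⊤ S w → Covers ⊤ S (updateAt w v pred)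
    loose-decrement w {v} loose covers {X} ne with v ∈? X
    ... | no  v∉X = subst (λ z → ∣ induced ⊤ X ∣ + k ≤ z + rank (joined S X)) (sym (weight-decrement-∉ w v∉X)) (covers ne)
    ... | yes v∈X = s≤s⁻¹ (begin
      suc (∣ induced ⊤ X ∣ + k)                ≤⟨ ≰⇒> (λ tight → loose (X , v∈X , tight)) ⟩
      weight w X + rank (joined S X ∪ ⊥)       ≤⟨ +-monoʳ-≤ (weight w X) (rank-mono (∪-least ⊆-refl (⊆-min _))) ⟩
      weight w X + rank (joined S X)           ≡⟨ cong (_+ rank (joined S X)) (weight-decrement-∈ w v∈X (loose⇒positive w loose)) ⟩
      suc (weight (updateAt w v pred) X + rank (joined S X))    ∎)
      where open ≤-Reasoning

    -- Each step lowers w(V) by one, so w(V) serves as fuel. The process stops when every vertex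
    -- lies in a tight set; uniting overlapping tight sets then gives a partition to which
    -- `tight-partition` applies.
    lower-demand : ∀ fuel w → weight w ⊤ ≤ fuel → Covers ⊤ S w →
      ∃[ w′ ] Covers ⊤ S w′ × weight w′ ⊤ ≤ m
    lower-demand fuel w bound covers with all? (inTight? w)
    ... | yes tight =
      let P , tightP = partition-within (Tight ⊤ S w ⊥) (tight-∪ {⊤} {S} {w} covers {⊥}) tight
      in w , covers , tight-partition w P tightP
    ... | no ¬tight with ¬∀⟶∃¬ n (InTight w) (inTight? w) ¬tight
    lower-demand zero w bound covers | no _ | v , loose =
      contradiction (≤-trans (loose⇒positive w loose) (≤-trans (lookup≤weight w {⊤} ∈⊤) bound)) λ ()
    lower-demand (suc fuel) w bound covers | no _ | v , loose =
      lower-demand fuel (updateAt w v pred)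
        (s≤s⁻¹ (subst (_≤ suc fuel) (weight-decrement-∈ w ∈⊤ (loose⇒positive w loose)) bound))
        (loose-decrement w loose covers)

    demand-exists : ∃[ w ] Covers ⊤ S w × weight w ⊤ ≤ m
    -- With weight m + k on every vertex, a single vertex of X already pays for all edges and for k.
    demand-exists = lower-demand _ (replicate n (m + k)) ≤-refl λ { {X} (v , v∈X) → begin
      ∣ induced ⊤ X ∣ + k                       ≤⟨ +-monoˡ-≤ k (∣p∣≤n (induced ⊤ X)) ⟩
      m + k                                     ≡⟨ lookup-replicate v (m + k) ⟨
      Vec.lookup (replicate n (m + k)) v        ≤⟨ lookup≤weight (replicate n (m + k)) v∈X ⟩
      weight (replicate n (m + k)) X            ≤⟨ m≤m+n _ _ ⟩
      weight (replicate n (m + k)) X + rank (joined S X) ∎ }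
      where open ≤-Reasoning

-- Span in a matroid

module Span {t} (M : Matroid t) where
  open Matroid M
  open Rank M

  private
    spanned? : ∀ A → Decidable (λ s → rank (A ∪ ⁅ s ⁆) ≤ rank A)
    spanned? A s = _ ≤? _

  span : Subset t → Subset t
  span A = setOf (spanned? A)

  ∈-span⁺ : ∀ {A s} → rank (A ∪ ⁅ s ⁆) ≤ rank A → s ∈ span A
  ∈-span⁺ {A} = ∈-setOf⁺ (spanned? A)

  ∈-span⁻ : ∀ {A s} → s ∈ span A → rank (A ∪ ⁅ s ⁆) ≤ rank A
  ∈-span⁻ {A} = ∈-setOf⁻ (spanned? A)

  ⊆-span : ∀ {A} → A ⊆ span A
  ⊆-span s∈A = ∈-span⁺ (rank-mono (∪-least ⊆-refl (⁅⁆⊆ s∈A)))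

  -- If the rank grew, a basis I of A could be augmented by some e in A ∪ B. Then I with e would be
  -- independent inside A ∪ ⁅ e ⁆ and larger than rank A, although e is spanned by A.
  rank-span : ∀ {A B} → B ⊆ span A → rank (A ∪ B) ≤ rank A
  rank-span {A} {B} B⊆ with rank-attained A | rank-attained (A ∪ B)
  ... | I , indI , I⊆A , ∣I∣≡ | K , indK , K⊆ , ∣K∣≡ = ≮⇒≥ λ lt →
    let e , e∈K , e∉I , indI+e = augmentation indI indK (subst₂ _<_ (sym ∣I∣≡) (sym ∣K∣≡) lt)
        e∈span = [ ⊆-span , B⊆ ]′ (x∈p∪q⁻ A B (K⊆ e∈K))
    in contradiction (begin-strict
      rank A              ≡⟨ ∣I∣≡ ⟨
      ∣ I ∣               <⟨ p⊂q⇒∣p∣<∣q∣ (p⊆p∪q _ , e , ∈-insert I , e∉I) ⟩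
      ∣ I ∪ ⁅ e ⁆ ∣       ≤⟨ rank-upper indI+e (insert-mono I⊆A) ⟩
      rank (A ∪ ⁅ e ⁆)    ≤⟨ ∈-span⁻ e∈span ⟩
      rank A              ∎) (<-irrefl refl)
    where open ≤-Reasoning

  -- By submodularity, an element that does not raise the rank of B does not raise that of A ∪ B,
  -- and A ∪ B has the same rank as A.
  span-⊆ : ∀ {A B} → B ⊆ span A → span B ⊆ span A
  span-⊆ {A} {B} B⊆ {s} s∈ = ∈-span⁺ (begin
    rank (A ∪ ⁅ s ⁆)    ≤⟨ rank-mono (insert-mono (p⊆p∪q B)) ⟩
    rank ((A ∪ B) ∪ ⁅ s ⁆)
                        ≤⟨ +-cancelˡ-≤ (rank B) _ _ (≤-trans (rank-submodular (q⊆p∪q A B) (p⊆p∪q ⁅ s ⁆)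
                             (∪-least (p⊆p∪q _) (q⊆p∪q (A ∪ B) _ ∘ q⊆p∪q B _)))
                             (subst (rank (A ∪ B) + rank (B ∪ ⁅ s ⁆) ≤_) (+-comm (rank (A ∪ B)) (rank B))
                               (+-monoʳ-≤ (rank (A ∪ B)) (∈-span⁻ s∈)))) ⟩
    rank (A ∪ B)        ≤⟨ rank-span B⊆ ⟩
    rank A              ∎)
    where open ≤-Reasoning

-- Choosing an edge and a root to extend along it

module Augmentation {n m t} (G : Graph n m) (M : Matroid t) where
  open Graph G
  open Matroid M using (rank)
  open Rank M
  open Span M
  open Demands G M

  Joins : Fin m → Fin n → Fin n → Set
  Joins e x y = ends e ≡ (x , y) ⊎ ends e ≡ (y , x)

  module _ {E : Subset m} {S : Fin n → Subset t} (w : Vec ℕ n) (covers : Covers E S w) where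

    module _ {X v} (tight : Tight E S w ⊥ X) (v∈X : v ∈ X) (deficient : rank (S v) < rank (joined S X)) where

      private
        absorbed? : Decidable (λ u → u ∈ X × S u ⊆ span (S v))
        absorbed? u = (u ∈? X) ×-dec (S u ⊆? span (S v))

        Y Z : Subset n
        Y = setOf absorbed?
        Z = X ─ Y

        Y⊆X : Y ⊆ X
        Y⊆X = proj₁ ∘ ∈-setOf⁻ absorbed?

        Crossing : Fin n → Fin n → Set
        Crossing x y = x ∈ Z × y ∈ Y

        EdgeAcross : Fin m → Set
        EdgeAcross e = e ∈ E × (Crossing (proj₁ (ends e)) (proj₂ (ends e)) ⊎
                                Crossing (proj₂ (ends e)) (proj₁ (ends e)))

        edgeAcross? : Decidable EdgeAcross
        edgeAcross? e = (e ∈? E) ×-dec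
          (((proj₁ (ends e) ∈? Z) ×-dec (proj₂ (ends e) ∈? Y)) ⊎-dec
           ((proj₂ (ends e) ∈? Z) ×-dec (proj₁ (ends e) ∈? Y)))

        rank-Y : rank (joined S Y) ≤ rank (S v)
        rank-Y = ≤-trans (rank-mono (q⊆p∪q (S v) (joined S Y)))
          (rank-span λ s∈ → let _ , u∈Y , s∈Su = ∈-joined⁻ s∈ in proj₂ (∈-setOf⁻ absorbed? u∈Y) s∈Su)

        -- For nonempty Z the k in `Covers` absorbs the rank. An empty Z is outside the scope of
        -- `Covers` but induces no edges.
        supply-Z : ∣ induced E Z ∣ ≤ weight w Z
        supply-Z with nonempty? Z
        ... | yes ne = +-cancelʳ-≤ k _ _ (≤-trans (covers ne) (+-monoʳ-≤ (weight w Z) (rank≤k (joined S Z))))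
        ... | no ¬ne = subst (_≤ weight w Z) (sym (trans (cong ∣_∣ induced-empty) (∣⊥∣≡0 m))) z≤n
          where
          induced-empty : induced E Z ≡ ⊥
          induced-empty = Empty-unique λ { (e , e∈) → ¬ne (_ , proj₁ (proj₂ (∈-induced⁻ e∈))) }

        split : ¬ ∃ EdgeAcross → induced E X ⊆ induced E Y ∪ induced E Z
        split none {e} e∈ with ∈-induced⁻ e∈
        ... | e∈E , p∈X , q∈X with proj₁ (ends e) ∈? Y | proj₂ (ends e) ∈? Y
        ... | yes p∈Y | yes q∈Y = x∈p∪q⁺ (inj₁ (∈-induced⁺ e∈E p∈Y q∈Y))
        ... | no  p∉Y | no  q∉Y = x∈p∪q⁺ (inj₂ (∈-induced⁺ e∈E (x∈p∧x∉q⇒x∈p─q p∈X p∉Y) (x∈p∧x∉q⇒x∈p─q q∈X q∉Y)))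
        ... | yes p∈Y | no  q∉Y = contradiction (e , e∈E , inj₂ (x∈p∧x∉q⇒x∈p─q q∈X q∉Y , p∈Y)) none
        ... | no  p∉Y | yes q∈Y = contradiction (e , e∈E , inj₁ (x∈p∧x∉q⇒x∈p─q p∈X p∉Y , q∈Y)) none

        -- Without such an edge, i(X) ≤ i(Y) + i(Z). Applying `Covers` to Y, which contains v, and
        -- `supply-Z` to Z, tightness of X gives f(X) ≤ f(Y), and f(Y) is at most the rank of S v.
        -- This contradicts deficiency.
        edge-across : ∃ EdgeAcross
        edge-across = decidable-stable (any? edgeAcross?) λ none →
          <⇒≱ deficient (≤-trans (+-cancelˡ-≤ (weight w X) _ _ (begin
            weight w X + rank (joined S X)
              ≤⟨ +-monoʳ-≤ (weight w X) (rank-mono (p⊆p∪q ⊥)) ⟩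
            weight w X + rank (joined S X ∪ ⊥)
              ≤⟨ tight ⟩
            ∣ induced E X ∣ + k
              ≤⟨ +-monoˡ-≤ k (∣∣-∪-≤ (split none)) ⟩
            (∣ induced E Y ∣ + ∣ induced E Z ∣) + k
              ≡⟨ xy∙z≈xz∙y ∣ induced E Y ∣ ∣ induced E Z ∣ k ⟩
            (∣ induced E Y ∣ + k) + ∣ induced E Z ∣
              ≤⟨ +-mono-≤ (covers (v , ∈-setOf⁺ absorbed? (v∈X , ⊆-span))) supply-Z ⟩
            (weight w Y + rank (joined S Y)) + weight w Z
              ≡⟨ xy∙z≈xz∙y (weight w Y) (rank (joined S Y)) (weight w Z) ⟩
            (weight w Y + weight w Z) + rank (joined S Y)
              ≤⟨ +-monoˡ-≤ (rank (joined S Y)) (weight-disjoint w Y⊆X (p─q⊆p X Y)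
                   λ { (u , u∈) → let u∈Y , u∈Z = x∈p∩q⁻ Y Z u∈ in proj₂ (∈-─⁻ X Y u∈Z) u∈Y }) ⟩
            weight w X + rank (joined S Y) ∎)) rank-Y)
          where open ≤-Reasoning

        -- Since y ∈ Y, the span of S y lies in the span of S v; since x ∉ Y, the set S x does not.
        escapes : ∀ {x y} → Crossing x y → ∃[ s ] s ∈ S x × s ∉ span (S y)
        escapes {x} {y} (x∈Z , y∈Y) = decidable-stable (any? λ s → (s ∈? S x) ×-dec ¬? (s ∈? span (S y)))
          λ none → let x∈X , x∉Y = ∈-─⁻ X Y x∈Z in
            x∉Y (∈-setOf⁺ absorbed? (x∈X , λ {s} s∈Sx →
              span-⊆ (proj₂ (∈-setOf⁻ absorbed? y∈Y))
                (decidable-stable (s ∈? span (S y)) λ s∉ → none (s , s∈Sx , s∉))))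

        from-crossing : ∀ {e x y} → e ∈ E → Joins e x y → Crossing x y →
          ∃[ e ] ∃[ x ] ∃[ y ] ∃[ s ] e ∈ E × Joins e x y × x ∈ X × y ∈ X × s ∈ S x × s ∉ span (S y)
        from-crossing e∈E joins crossing@(x∈Z , y∈Y) =
          let s , s∈Sx , s∉ = escapes crossing in
          _ , _ , _ , s , e∈E , joins , p─q⊆p X Y x∈Z , Y⊆X y∈Y , s∈Sx , s∉

      transfer-edge :
        ∃[ e ] ∃[ x ] ∃[ y ] ∃[ s ] e ∈ E × Joins e x y × x ∈ X × y ∈ X × s ∈ S x × s ∉ span (S y)
      transfer-edge = let _ , e∈E , crossing = edge-across in
        [ from-crossing e∈E (inj₁ refl) , from-crossing e∈E (inj₂ refl) ]′ crossing

    -- These are the sets in which lowering w y breaks `Covers`: as x lies outside, removing an edge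
    -- between x and y leaves the supply unchanged, and even after adding s there is no slack.
    Blocks : Fin n → Fin n → Fin t → Subset n → Set
    Blocks x y s X = x ∉ X × y ∈ X × Tight E S w ⁅ s ⁆ X

    Transfer : Set
    Transfer = ∃[ e ] ∃[ x ] ∃[ y ] ∃[ s ]
      e ∈ E × Joins e x y × s ∈ S x × s ∉ span (S y) × ¬ ∃ (Blocks x y s)

    blocks? : ∀ x y s → Decidable (Blocks x y s)
    blocks? x y s X = ¬? (x ∈? X) ×-dec (y ∈? X) ×-dec tight? E S w ⁅ s ⁆ X

    module _ {X X′ x y s} (tight : Tight E S w ⊥ X) (x∈X : x ∈ X) (y∈X : y ∈ X)
             (s∈Sx : s ∈ S x) (s∉ : s ∉ span (S y)) (blocks : Blocks x y s X′) where

      private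
        y∈∩ : y ∈ X ∩ X′
        y∈∩ = x∈p∩q⁺ (y∈X , proj₁ (proj₂ blocks))

        -- The root s already belongs to `joined S X`, so adding it changes nothing. This makes X
        -- and X′ tight for the same A and lets them be uncrossed.
        tight-s : Tight E S w ⁅ s ⁆ X
        tight-s = ≤-trans (+-monoʳ-≤ (weight w X) (rank-mono (p⊆p∪q ⊥ ∘ ∪-least ⊆-refl (⁅⁆⊆ (∈-joined⁺ x∈X s∈Sx))))) tight

        tight-s∩ : Tight E S w ⁅ s ⁆ (X ∩ X′)
        tight-s∩ = tight-∩ {E} {S} {w} covers {⁅ s ⁆} (y , y∈∩) tight-s (proj₂ (proj₂ blocks))

      blocked-smaller : X ∩ X′ ⊂ X
      blocked-smaller = p∩q⊆p X X′ , x , x∈X , proj₁ blocks ∘ p∩q⊆q X X′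

      blocked-tight : Tight E S w ⊥ (X ∩ X′)
      blocked-tight = ≤-trans (+-monoʳ-≤ (weight w (X ∩ X′)) (rank-mono (∪-least (p⊆p∪q _) (⊆-min _)))) tight-s∩

      -- Tightness with s together with `Covers` shows that s does not raise the rank of the roots
      -- joined over X ∩ X′, whereas it does raise the rank of S y. Hence y can take the role of v
      -- in the smaller set.
      blocked-deficient : rank (S y) < rank (joined S (X ∩ X′))
      blocked-deficient = begin-strict
        rank (S y)                         <⟨ ≰⇒> (s∉ ∘ ∈-span⁺) ⟩
        rank (S y ∪ ⁅ s ⁆)                 ≤⟨ rank-mono (insert-mono (∈-joined⁺ y∈∩)) ⟩
        rank (joined S (X ∩ X′) ∪ ⁅ s ⁆)   ≤⟨ +-cancelˡ-≤ (weight w (X ∩ X′)) _ _ (≤-trans tight-s∩ (covers (y , y∈∩))) ⟩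
        rank (joined S (X ∩ X′))           ∎
        where open ≤-Reasoning

    -- Descent on the tight set: `transfer-edge` proposes a choice inside X, and a set blocking it
    -- leads to the strictly smaller tight set X ∩ X′, in which y is deficient. The bound cannot
    -- reach 0 because X contains v.
    transfer-within : ∀ size {X v} → ∣ X ∣ ≤ size → Tight E S w ⊥ X → v ∈ X →
      rank (S v) < rank (joined S X) → Transfer
    transfer-within zero {X} {v} bound tight v∈X deficient =
      contradiction (≤-trans (≤-trans (≤-reflexive (sym (∣⁅x⁆∣≡1 v))) (p⊆q⇒∣p∣≤∣q∣ (⁅⁆⊆ v∈X))) bound) λ ()
    transfer-within (suc size) {X} bound tight v∈X deficient =
      let e , x , y , s , e∈E , joins , x∈X , y∈X , s∈Sx , s∉ = transfer-edge tight v∈X deficient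
      in unless-blocked e∈E joins x∈X y∈X s∈Sx s∉ (anySubset? (blocks? x y s))
      where
      unless-blocked : ∀ {e x y s} → e ∈ E → Joins e x y → x ∈ X → y ∈ X → s ∈ S x → s ∉ span (S y) →
        Dec (∃ (Blocks x y s)) → Transfer
      unless-blocked e∈E joins x∈X y∈X s∈Sx s∉ (no unblocked) =
        _ , _ , _ , _ , e∈E , joins , s∈Sx , s∉ , unblocked
      unless-blocked e∈E joins x∈X y∈X s∈Sx s∉ (yes (X′ , blocks)) =
        transfer-within size
          (s≤s⁻¹ (≤-trans (p⊂q⇒∣p∣<∣q∣ (blocked-smaller tight x∈X y∈X s∈Sx s∉ blocks)) bound))
          (blocked-tight tight x∈X y∈X s∈Sx s∉ blocks)
          (x∈p∩q⁺ (y∈X , proj₁ (proj₂ blocks)))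
          (blocked-deficient tight x∈X y∈X s∈Sx s∉ blocks)

    -- The descent starts from the whole vertex set. It is tight because w(V) is at most the number
    -- of unassigned edges, and `Covers` then forces its joined roots to have rank k.
    transfer-exists : weight w ⊤ ≤ ∣ E ∣ → ∀ {v} → rank (S v) < k → Transfer
    transfer-exists bound {v} deficient =
      transfer-within _ ≤-refl tight ∈⊤ (≤-trans deficient k≤)
      where
      open ≤-Reasoning
      E⊆ : E ⊆ induced E ⊤
      E⊆ e∈E = ∈-induced⁺ e∈E ∈⊤ ∈⊤

      tight : Tight E S w ⊥ ⊤
      tight = +-mono-≤ (≤-trans bound (p⊆q⇒∣p∣≤∣q∣ E⊆)) (rank≤k (joined S ⊤ ∪ ⊥))

      k≤ : k ≤ rank (joined S ⊤)
      k≤ = +-cancelˡ-≤ ∣ E ∣ _ _ (begin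
        ∣ E ∣ + k                       ≤⟨ +-monoˡ-≤ k (p⊆q⇒∣p∣≤∣q∣ E⊆) ⟩
        ∣ induced E ⊤ ∣ + k             ≤⟨ covers (v , ∈⊤) ⟩
        weight w ⊤ + rank (joined S ⊤)  ≤⟨ +-monoˡ-≤ (rank (joined S ⊤)) bound ⟩
        ∣ E ∣ + rank (joined S ⊤)       ∎)

    -- w y ≥ k − rank (S y) > 0 because s is not spanned by S y.
    demand-positive : ∀ {y s} → s ∉ span (S y) → 1 ≤ Vec.lookup w y
    demand-positive {y} {s} s∉ = n≢0⇒n>0 λ w[y]≡0 → s∉ (∈-span⁺ (begin
      rank (S y ∪ ⁅ s ⁆)                     ≤⟨ rank≤k (S y ∪ ⁅ s ⁆) ⟩
      k                                      ≤⟨ m≤n+m k _ ⟩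
      ∣ induced E ⁅ y ⁆ ∣ + k                ≤⟨ covers (y , x∈⁅x⁆ y) ⟩
      weight w ⁅ y ⁆ + rank (joined S ⁅ y ⁆) ≡⟨ cong (_+ rank (joined S ⁅ y ⁆)) (trans (weight-⁅⁆ w y) w[y]≡0) ⟩
      rank (joined S ⁅ y ⁆)                  ≤⟨ rank-mono joined-⁅⁆ ⟩
      rank (S y)                             ∎))
      where
      open ≤-Reasoning
      joined-⁅⁆ : joined S ⁅ y ⁆ ⊆ S y
      joined-⁅⁆ {i} i∈ with ∈-joined⁻ i∈
      ... | u , u∈ , i∈Su = subst (λ z → i ∈ S z) (x∈⁅y⁆⇒x≡y y u∈) i∈Su

    -- If y ∉ X, the weight is unchanged and the rest is monotone. If both ends are in X, the loss
    -- of e pays for the unit of weight lost. If only y is in X, then X is not blocking, so there is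
    -- a unit of slack once s is counted, and S′ y does contain s.
    transfer-covers : ∀ {e x y s S′} → e ∈ E → Joins e x y → s ∉ span (S y) → ¬ ∃ (Blocks x y s) →
      (∀ {u} → S u ⊆ S′ u) → s ∈ S′ y → Covers (E -ˢ e) S′ (updateAt w y pred)
    transfer-covers {e} {x} {y} {s} {S′} e∈E joins s∉ unblocked S⊆S′ s∈S′y {X} ne = cover
      where
      open ≤-Reasoning
      w′ : Vec ℕ n
      w′ = updateAt w y pred

      shrink : induced (E -ˢ e) X ⊆ induced E X
      shrink e′∈ with ∈-induced⁻ e′∈
      ... | e′∈E-e , p∈ , q∈ = ∈-induced⁺ (proj₁ (∈-remove⁻ E e′∈E-e)) p∈ q∈

      grow : joined S X ⊆ joined S′ X
      grow i∈ with ∈-joined⁻ i∈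
      ... | u , u∈X , i∈Su = ∈-joined⁺ u∈X (S⊆S′ i∈Su)

      ends∈ : x ∈ X → y ∈ X → proj₁ (ends e) ∈ X × proj₂ (ends e) ∈ X
      ends∈ x∈X y∈X = ends∈′ joins
        where
        ends∈′ : Joins e x y → proj₁ (ends e) ∈ X × proj₂ (ends e) ∈ X
        ends∈′ (inj₁ eq) rewrite eq = x∈X , y∈X
        ends∈′ (inj₂ eq) rewrite eq = y∈X , x∈X

      cover : ∣ induced (E -ˢ e) X ∣ + k ≤ weight w′ X + rank (joined S′ X)
      cover with y ∈? X
      ... | no y∉X = begin
        ∣ induced (E -ˢ e) X ∣ + k        ≤⟨ +-monoˡ-≤ k (p⊆q⇒∣p∣≤∣q∣ shrink) ⟩
        ∣ induced E X ∣ + k               ≤⟨ covers ne ⟩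
        weight w X + rank (joined S X)    ≤⟨ +-mono-≤ (≤-reflexive (sym (weight-decrement-∉ w y∉X))) (rank-mono grow) ⟩
        weight w′ X + rank (joined S′ X)  ∎
      ... | yes y∈X with x ∈? X
      ... | yes x∈X = s≤s⁻¹ (begin
        suc (∣ induced (E -ˢ e) X ∣ + k)        ≤⟨ +-monoˡ-≤ k (p⊂q⇒∣p∣<∣q∣ (shrink , e , e∈ , e∉)) ⟩
        ∣ induced E X ∣ + k                     ≤⟨ covers ne ⟩
        weight w X + rank (joined S X)          ≤⟨ +-mono-≤ (≤-reflexive (weight-decrement-∈ w y∈X (demand-positive s∉))) (rank-mono grow) ⟩
        suc (weight w′ X + rank (joined S′ X))  ∎)
        where
        e∈ : e ∈ induced E X
        e∈ = ∈-induced⁺ e∈E (proj₁ (ends∈ x∈X y∈X)) (proj₂ (ends∈ x∈X y∈X))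
        e∉ : e ∉ induced (E -ˢ e) X
        e∉ e∈′ = proj₂ (∈-remove⁻ E (proj₁ (∈-induced⁻ {E -ˢ e} e∈′))) refl
      ... | no x∉X = s≤s⁻¹ (begin
        suc (∣ induced (E -ˢ e) X ∣ + k)        ≤⟨ s≤s (+-monoˡ-≤ k (p⊆q⇒∣p∣≤∣q∣ shrink)) ⟩
        suc (∣ induced E X ∣ + k)               ≤⟨ ≰⇒> (λ tight → unblocked (X , x∉X , y∈X , tight)) ⟩
        weight w X + rank (joined S X ∪ ⁅ s ⁆)  ≤⟨ +-mono-≤ (≤-reflexive (weight-decrement-∈ w y∈X (demand-positive s∉)))
                                                            (rank-mono (∪-least grow (⁅⁆⊆ (∈-joined⁺ y∈X s∈S′y)))) ⟩
        suc (weight w′ X + rank (joined S′ X))  ∎)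

-- Rooted components

module Components {n m} (G : Graph n m) where
  open Graph G

  ∈-V⁺ : ∀ {F v e} → e ∈ F → Incident v e → v ∈ V[ F ]
  ∈-V⁺ {F} e∈F inc = ∈-setOf⁺ (λ v → any? λ e → (e ∈? F) ×-dec incident? v e) (_ , e∈F , inc)

  ∈-V⁻ : ∀ {F v} → v ∈ V[ F ] → ∃[ e ] e ∈ F × Incident v e
  ∈-V⁻ {F} = ∈-setOf⁻ (λ v → any? λ e → (e ∈? F) ×-dec incident? v e)

  V-mono : ∀ {F F′} → F ⊆ F′ → V[ F ] ⊆ V[ F′ ]
  V-mono F⊆F′ v∈ = let _ , e∈F , inc = ∈-V⁻ v∈ in ∈-V⁺ (F⊆F′ e∈F) inc

  Vᵣ-mono : ∀ {F F′ r} → F ⊆ F′ → Vᵣ F r ⊆ Vᵣ F′ r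
  Vᵣ-mono F⊆F′ = ∪-least (p⊆p∪q _ ∘ V-mono F⊆F′) (q⊆p∪q _ _)

  Path : Subset m → Fin n → Fin n → Set
  Path F = Star (Adjacent F)

  adjacent-sym : ∀ {F u v} → Adjacent F u v → Adjacent F v u
  adjacent-sym (e , e∈F , inj₁ eq) = e , e∈F , inj₂ eq
  adjacent-sym (e , e∈F , inj₂ eq) = e , e∈F , inj₁ eq

  path-mono : ∀ {F F′ u v} → F ⊆ F′ → Path F u v → Path F′ u v
  path-mono F⊆F′ = Star.map λ { (e , e∈F , joins) → e , F⊆F′ e∈F , joins }

  path-from-root : ∀ {F r u} → RootedComponent F r → u ∈ Vᵣ F r → Path F r u
  path-from-root {F} {r} {u} comp u∈ with x∈p∪q⁻ V[ F ] _ u∈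
  ... | inj₂ u∈⁅r⁆ = subst (Path F r) (sym (x∈⁅y⁆⇒x≡y r u∈⁅r⁆)) ε
  path-from-root (inj₁ refl)              u∈ | inj₁ u∈V = contradiction (proj₁ (proj₂ (∈-V⁻ u∈V))) ∉⊥
  path-from-root (inj₂ (connected , r∈V)) u∈ | inj₁ u∈V = connected r∈V u∈V

  ends-incident : ∀ {e x y} → Adjacent ⁅ e ⁆ x y → Incident x e × Incident y e
  ends-incident {e} (e′ , e′∈ , joins) with x∈⁅y⁆⇒x≡y e e′∈
  ends-incident (e , _ , inj₁ eq) | refl = inj₁ (sym (cong proj₁ eq)) , inj₂ (sym (cong proj₂ eq))
  ends-incident (e , _ , inj₂ eq) | refl = inj₂ (sym (cong proj₂ eq)) , inj₁ (sym (cong proj₁ eq))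

  incident⇒end : ∀ {e x y u} → Adjacent ⁅ e ⁆ x y → Incident u e → u ≡ x ⊎ u ≡ y
  incident⇒end {e} (e′ , e′∈ , joins) inc with x∈⁅y⁆⇒x≡y e e′∈
  incident⇒end (e , _ , inj₁ eq) (inj₁ u≡) | refl = inj₁ (trans u≡ (cong proj₁ eq))
  incident⇒end (e , _ , inj₁ eq) (inj₂ u≡) | refl = inj₂ (trans u≡ (cong proj₂ eq))
  incident⇒end (e , _ , inj₂ eq) (inj₁ u≡) | refl = inj₂ (trans u≡ (cong proj₁ eq))
  incident⇒end (e , _ , inj₂ eq) (inj₂ u≡) | refl = inj₁ (trans u≡ (cong proj₂ eq))

  -- All vertices of the enlarged set are reachable from r, either within F or through x, so any two
  -- are joined by a path via r. If F is empty then x = r, and the new edge itself puts r into the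
  -- vertex set.
  add-edge : ∀ {F r e x y} → RootedComponent F r → x ∈ Vᵣ F r → Adjacent ⁅ e ⁆ x y →
    RootedComponent (F ∪ ⁅ e ⁆) r × y ∈ Vᵣ (F ∪ ⁅ e ⁆) r
  add-edge {F} {r} {e} {x} {y} comp x∈ adj =
    inj₂ ((λ u∈ v∈ → Star.reverse adjacent-sym (reachable u∈) ◅◅ reachable v∈) , r∈V) ,
    p⊆p∪q _ (∈-V⁺ (∈-insert F) (proj₂ (ends-incident adj)))
    where
    F′ : Subset m
    F′ = F ∪ ⁅ e ⁆

    to-old : ∀ {u} → u ∈ Vᵣ F r → Path F′ r u
    to-old = path-mono (p⊆p∪q _) ∘ path-from-root comp

    to-end : ∀ {u} → u ≡ x ⊎ u ≡ y → Path F′ r u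
    to-end (inj₁ refl) = to-old x∈
    to-end (inj₂ refl) = to-old x∈ ◅◅ path-mono (q⊆p∪q F _) (adj ◅ ε)

    reachable : ∀ {u} → u ∈ V[ F′ ] → Path F′ r u
    reachable u∈ with ∈-V⁻ u∈
    ... | e′ , e′∈ , inc with x∈p∪q⁻ F _ e′∈
    ... | inj₁ e′∈F = to-old (p⊆p∪q _ (∈-V⁺ e′∈F inc))
    ... | inj₂ e′∈⁅e⁆ = to-end (incident⇒end adj (subst (Incident _) (x∈⁅y⁆⇒x≡y e e′∈⁅e⁆) inc))

    root-in : RootedComponent F r → x ∈ V[ F ] → r ∈ V[ F′ ]
    root-in (inj₁ refl)      x∈V = contradiction (proj₁ (proj₂ (∈-V⁻ x∈V))) ∉⊥
    root-in (inj₂ (_ , r∈))  x∈V = V-mono (p⊆p∪q _) r∈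

    r∈V : r ∈ V[ F′ ]
    r∈V with x∈p∪q⁻ V[ F ] _ x∈
    ... | inj₂ x∈⁅r⁆ = subst (_∈ V[ F′ ]) (x∈⁅y⁆⇒x≡y r x∈⁅r⁆) (∈-V⁺ (∈-insert F) (proj₁ (ends-incident adj)))
    ... | inj₁ x∈V = root-in comp x∈V

  module _ {t} (root : Fin t → Fin n) where

    ∈-reaching⁺ : ∀ C v {i} → v ∈ Vᵣ (C i) (root i) → i ∈ rootsReaching root C v
    ∈-reaching⁺ C v = ∈-setOf⁺ (λ i → v ∈? Vᵣ (C i) (root i))

    ∈-reaching⁻ : ∀ C v {i} → i ∈ rootsReaching root C v → v ∈ Vᵣ (C i) (root i)
    ∈-reaching⁻ C v = ∈-setOf⁻ (λ i → v ∈? Vᵣ (C i) (root i))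

    -- E holds the edges not yet assigned: together with the sets C i it splits the edge set, some
    -- of these possibly empty.
    record PartialDecomposition (E : Subset m) (C : Fin t → Subset m) : Set where
      field
        disjoint  : ∀ {i j} → i ≢ j → Empty (C i ∩ C j)
        fresh     : ∀ {e i} → e ∈ E → e ∉ C i
        covers    : ∀ e → e ∈ E ⊎ (∃[ i ] e ∈ C i)
        component : ∀ i → RootedComponent (C i) (root i)

    assign : (Fin t → Subset m) → Fin t → Fin m → Fin t → Subset m
    assign C s e i with i ≟ᶠ s
    ... | yes _ = C i ∪ ⁅ e ⁆
    ... | no  _ = C i

    module _ {C : Fin t → Subset m} {s : Fin t} {e : Fin m} where

      assign-⊇ : ∀ i → C i ⊆ assign C s e i
      assign-⊇ i with i ≟ᶠ s
      ... | yes _ = p⊆p∪q _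
      ... | no  _ = ⊆-refl

      assign-≡ : assign C s e s ≡ C s ∪ ⁅ e ⁆
      assign-≡ with s ≟ᶠ s
      ... | yes _  = refl
      ... | no s≢s = contradiction refl s≢s

      assign-∈⁻ : ∀ i {e′} → e′ ∈ assign C s e i → e′ ∈ C i ⊎ (i ≡ s × e′ ≡ e)
      assign-∈⁻ i e′∈ with i ≟ᶠ s
      ... | no  _ = inj₁ e′∈
      ... | yes i≡s with x∈p∪q⁻ (C i) _ e′∈
      ... | inj₁ e′∈C = inj₁ e′∈C
      ... | inj₂ e′∈⁅e⁆ = inj₂ (i≡s , x∈⁅y⁆⇒x≡y e e′∈⁅e⁆)

      assign-component : (∀ i → RootedComponent (C i) (root i)) →
        RootedComponent (C s ∪ ⁅ e ⁆) (root s) → ∀ i → RootedComponent (assign C s e i) (root i)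
      assign-component comp comp-s i with i ≟ᶠ s
      ... | yes refl = comp-s
      ... | no  _    = comp i

      reaching-assign : ∀ v → rootsReaching root C v ⊆ rootsReaching root (assign C s e) v
      reaching-assign v {i} i∈ =
        ∈-reaching⁺ (assign C s e) v (Vᵣ-mono (assign-⊇ i) (∈-reaching⁻ C v i∈))

    module _ {E C e x y s} (partial : PartialDecomposition E C) (e∈E : e ∈ E)
             (s∈ : s ∈ rootsReaching root C x) (adj : Adjacent ⁅ e ⁆ x y) where
      open PartialDecomposition partial

      private
        added : RootedComponent (C s ∪ ⁅ e ⁆) (root s) × y ∈ Vᵣ (C s ∪ ⁅ e ⁆) (root s)
        added = add-edge (component s) (∈-reaching⁻ C x s∈) adj

      assign-reaches : s ∈ rootsReaching root (assign C s e) y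
      assign-reaches = ∈-reaching⁺ (assign C s e) y
        (subst (λ F → y ∈ Vᵣ F (root s)) (sym (assign-≡ {C})) (proj₂ added))

      assign-partial : PartialDecomposition (E -ˢ e) (assign C s e)
      assign-partial = record
        { disjoint  = λ { {i} {j} i≢j (e′ , e′∈) → let e′∈i , e′∈j = x∈p∩q⁻ (assign C s e i) _ e′∈ in
                          disjoint′ i≢j (assign-∈⁻ i e′∈i) (assign-∈⁻ j e′∈j) }
        ; fresh     = λ {_} {i} e′∈ e′∈C → fresh′ (∈-remove⁻ E e′∈) (assign-∈⁻ i e′∈C)
        ; covers    = λ e′ → covers′ e′ (covers e′)
        ; component = assign-component component (proj₁ added)
        }
        where
        disjoint′ : ∀ {i j e′} → i ≢ j → e′ ∈ C i ⊎ (i ≡ s × e′ ≡ e) → e′ ∈ C j ⊎ (j ≡ s × e′ ≡ e) → Data.Empty.⊥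
        disjoint′ i≢j (inj₁ e′∈i)        (inj₁ e′∈j)        = disjoint i≢j (_ , x∈p∩q⁺ (e′∈i , e′∈j))
        disjoint′ i≢j (inj₁ e∈i)         (inj₂ (_ , refl))  = fresh e∈E e∈i
        disjoint′ i≢j (inj₂ (_ , refl))  (inj₁ e∈j)         = fresh e∈E e∈j
        disjoint′ i≢j (inj₂ (i≡s , _))   (inj₂ (j≡s , _))   = i≢j (trans i≡s (sym j≡s))

        fresh′ : ∀ {e′ i} → e′ ∈ E × e′ ≢ e → e′ ∈ C i ⊎ (i ≡ s × e′ ≡ e) → Data.Empty.⊥
        fresh′ (e′∈E , _)    (inj₁ e′∈C)      = fresh e′∈E e′∈C
        fresh′ (_    , e′≢e) (inj₂ (_ , e′≡e)) = e′≢e e′≡e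

        covers′ : ∀ e′ → e′ ∈ E ⊎ (∃[ i ] e′ ∈ C i) → e′ ∈ E -ˢ e ⊎ (∃[ i ] e′ ∈ assign C s e i)
        covers′ e′ (inj₂ (i , e′∈C)) = inj₂ (i , assign-⊇ i e′∈C)
        covers′ e′ (inj₁ e′∈E) with e′ ≟ᶠ e
        ... | no e′≢e  = inj₁ (x∈p∧x≢y⇒x∈p-y e′∈E e′≢e)
        ... | yes refl = inj₂ (s , subst (e ∈_) (sym (assign-≡ {C})) (∈-insert (C s)))

    -- Any component reaching the first end of a leftover edge can take that edge. Reaching sets
    -- only grow, so every vertex stays reached and any spanning property gained earlier is kept.
    -- The fuel bounds the number of leftover edges.
    complete : ∀ fuel {E C} → ∣ E ∣ ≤ fuel → PartialDecomposition E C →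
      (∀ v → Nonempty (rootsReaching root C v)) →
      ∃[ C′ ] IsDecomposition root C′ × (∀ v → rootsReaching root C v ⊆ rootsReaching root C′ v)
    complete fuel {E} {C} bound partial reached with nonempty? E
    ... | no E=∅ = C , record
        { disjoint  = disjoint
        ; covers    = λ e → [ (λ e∈E → contradiction (e , e∈E) E=∅) , (λ e∈C → e∈C) ]′ (covers e)
        ; component = component
        } , λ _ → ⊆-refl
      where open PartialDecomposition partial
    complete zero {E} bound partial reached | yes (e , e∈E) =
      contradiction (≤-trans (x∈p⇒∣p-x∣<∣p∣ e∈E) bound) λ ()
    complete (suc fuel) {E} {C} bound partial reached | yes (e , e∈E) =
      let x , y = ends e
          s , s∈ = reached x
          C′ , decomposition , grown = complete fuel {C = assign C s e}
            (s≤s⁻¹ (≤-trans (x∈p⇒∣p-x∣<∣p∣ e∈E) bound))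
            (assign-partial partial e∈E s∈ (e , x∈⁅x⁆ e , inj₁ refl))
            (λ v → let i , i∈ = reached v in i , reaching-assign {C} v i∈)
      in C′ , decomposition , λ v → grown v ∘ reaching-assign {C} v

-- Sufficiency of the partition condition

module Sufficiency {n m t} (G : Graph n m) (root : Fin t → Fin n) (M : Matroid t) where
  open Graph G
  open Matroid M using (rank; Spanning)
  open Rank M
  open Demands G M
  open Augmentation G M
  open Components G

  Full : (Fin t → Subset m) → Set
  Full C = ∀ v → k ≤ rank (rootsReaching root C v)

  -- Every transfer assigns one edge, so the number of unassigned edges bounds the recursion. Both
  -- invariants, `Covers` and w(V) ≤ ∣ E ∣, pass to the smaller instance.
  grow : ∀ fuel {E C} w → ∣ E ∣ ≤ fuel → PartialDecomposition root E C →
    Covers E (rootsReaching root C) w → weight w ⊤ ≤ ∣ E ∣ →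
    ∃[ E′ ] ∃[ C′ ] PartialDecomposition root E′ C′ × Full C′
  grow fuel {E} {C} w ∣E∣≤ partial covers bound =
    unless-full fuel ∣E∣≤ (all? λ v → k ≤? rank (rootsReaching root C v))
    where
    advance : ∀ fuel → ∣ E ∣ ≤ fuel → Transfer w covers →
      ∃[ E′ ] ∃[ C′ ] PartialDecomposition root E′ C′ × Full C′
    advance zero ∣E∣≤ (e , _ , _ , _ , e∈E , _) =
      contradiction (≤-trans (x∈p⇒∣p-x∣<∣p∣ e∈E) ∣E∣≤) λ ()
    advance (suc fuel) ∣E∣≤ (e , x , y , s , e∈E , joins , s∈ , s∉ , unblocked) =
      grow fuel (updateAt w y pred)
        (s≤s⁻¹ (≤-trans (x∈p⇒∣p-x∣<∣p∣ e∈E) ∣E∣≤))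
        (assign-partial root partial e∈E s∈ adj)
        (transfer-covers w covers e∈E joins s∉ unblocked (λ {u} → reaching-assign root {C} u) (assign-reaches root partial e∈E s∈ adj))
        -- The weight drops by exactly one and the number of edges by at most one, so the bound
        -- survives.
        (s≤s⁻¹ (begin
          suc (weight (updateAt w y pred) ⊤)   ≡⟨ weight-decrement-∈ w ∈⊤ (demand-positive w covers s∉) ⟨
          weight w ⊤                           ≤⟨ bound ⟩
          ∣ E ∣                                ≤⟨ ∣p∣≤1+∣p-x∣ E e ⟩
          suc ∣ E -ˢ e ∣                       ∎))
      where
      open ≤-Reasoning
      adj : Adjacent ⁅ e ⁆ x y
      adj = e , x∈⁅x⁆ e , joins

    unless-full : ∀ fuel → ∣ E ∣ ≤ fuel → Dec (Full C) →
      ∃[ E′ ] ∃[ C′ ] PartialDecomposition root E′ C′ × Full C′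
    unless-full fuel ∣E∣≤ (yes full)  = E , C , partial , full
    unless-full fuel ∣E∣≤ (no ¬full) =
      let v , ≰ = ¬∀⟶∃¬ n _ (λ v → k ≤? rank (rootsReaching root C v)) ¬full
      in advance fuel ∣E∣≤ (transfer-exists w covers bound {v} (≰⇒> ≰))

  ∅-components : Fin t → Subset m
  ∅-components _ = ⊥

  open Demands-existence G M (rootsReaching root ∅-components)

  sufficiency : 1 ≤ k →
    (∀ P → k ℕ.* Partition.size P ≤ ∣ δ G P ∣ + sum (λ i → rank (rootsIn root (Partition.part P i)))) →
    ∃[ C ] IsDecomposition root C × (∀ v → Spanning (rootsReaching root C v))
  sufficiency 1≤k condition =
    let w , covers , bound = demand-exists λ P → ≤-trans (condition P)
          (+-monoʳ-≤ ∣ δ G P ∣ (sum-mono λ i → rank-mono (rootsIn⊆ (Partition.part P i))))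
        _ , C , partial , full = grow _ w ≤-refl start covers (≤-trans bound (≤-reflexive (sym (∣⊤∣≡n m))))
        C′ , decomposition , grown = complete root _ ≤-refl partial (λ v → reached (full v))
    in C′ , decomposition , λ v → ≤-antisym (rank≤k _) (≤-trans (full v) (rank-mono (grown v)))
    where
    -- With all components empty, a root still reaches its own vertex, so the condition on `rootsIn`
    -- implies the one on `joined`.
    rootsIn⊆ : ∀ X → rootsIn root X ⊆ joined (rootsReaching root ∅-components) X
    rootsIn⊆ X {i} i∈ = ∈-joined⁺ (∈-setOf⁻ (λ i → root i ∈? X) i∈)
      (∈-reaching⁺ root ∅-components (root i) (q⊆p∪q _ _ (x∈⁅x⁆ (root i))))

    start : PartialDecomposition root ⊤ ∅-components
    start = record
      { disjoint  = λ { _ (e , e∈) → ∉⊥ (p∩q⊆p ⊥ ⊥ e∈) }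
      ; fresh     = λ _ → ∉⊥
      ; covers    = λ _ → inj₁ ∈⊤
      ; component = λ _ → inj₁ refl
      }

    -- Here 1 ≤ k enters: a set of positive rank is nonempty, so every leftover edge has a component
    -- to join.
    reached : ∀ {A} → k ≤ rank A → Nonempty A
    reached {A} k≤ = decidable-stable (nonempty? A) λ A=∅ →
      contradiction (≤-trans 1≤k (≤-trans k≤ (≤-trans (rank≤∣∣ A)
        (≤-reflexive (trans (cong ∣_∣ (Empty-unique A=∅)) (∣⊥∣≡0 t)))))) λ ()

-- Necessity of the partition condition

module Necessity {n m t} (G : Graph n m) (root : Fin t → Fin n) (M : Matroid t) (P : Partition n) where
  open Graph G
  open Matroid M using (rank; Spanning)
  open Rank M
  open Components G
  open Partition P

  label : Fin n → Fin size
  label v = proj₁ (covers v)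

  representative : Fin size → Fin n
  representative x = proj₁ (nonempty x)

  label-part : ∀ {v x} → v ∈ part x → label v ≡ x
  label-part v∈ = part-unique P (proj₂ (covers _)) v∈

  -- T is a set of parts, given by their indices. Edges between two parts of T are counted too,
  -- because a component may reach one part of T only through another.
  Enters : Subset m → Subset size → Fin m → Set
  Enters F T e = e ∈ F × label (proj₁ (ends e)) ≢ label (proj₂ (ends e)) ×
    (label (proj₁ (ends e)) ∈ T ⊎ label (proj₂ (ends e)) ∈ T)

  enters? : ∀ F T → Decidable (Enters F T)
  enters? F T e = (e ∈? F) ×-dec ¬? (label (proj₁ (ends e)) ≟ᶠ label (proj₂ (ends e))) ×-dec
    ((label (proj₁ (ends e)) ∈? T) ⊎-dec (label (proj₂ (ends e)) ∈? T))

  entering : Subset m → Subset size → Subset m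
  entering F T = setOf (enters? F T)

  first-entry : ∀ {F T u v} → Path F u v → label u ∉ T → label v ∈ T →
    ∃[ a ] ∃[ b ] Adjacent F a b × label a ∉ T × label b ∈ T
  first-entry ε                              u∉ v∈ = contradiction v∈ u∉
  first-entry {T = T} (_◅_ {j = w} adj path) u∉ v∈ with label w ∈? T
  ... | yes w∈ = _ , w , adj , u∉ , w∈
  ... | no  w∉ = first-entry path w∉ v∈

  -- The part of b is the only part of T that the edge touches, so the edge stops entering once that
  -- part is removed.
  entry-edge : ∀ {F T a b} → Adjacent F a b → label a ∉ T → label b ∈ T →
    ∃[ e ] e ∈ entering F T × e ∉ entering F (T -ˢ label b)
  entry-edge {F} {T} {a} {b} (e , e∈F , inj₁ eq) a∉ b∈ = e ,
    ∈-setOf⁺ (enters? F T) (e∈F , differ , inj₂ (subst (λ v → label v ∈ T) (sym (cong proj₂ eq)) b∈)) ,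
    λ e∈ → [ (λ p∈ → a∉ (proj₁ (∈-remove⁻ T (subst (λ v → label v ∈ T -ˢ label b) (cong proj₁ eq) p∈)))) ,
             (λ q∈ → proj₂ (∈-remove⁻ T q∈) (cong label (cong proj₂ eq))) ]′
           (proj₂ (proj₂ (∈-setOf⁻ (enters? F (T -ˢ label b)) e∈)))
    where
    differ : label (proj₁ (ends e)) ≢ label (proj₂ (ends e))
    differ same rewrite eq = a∉ (subst (_∈ T) (sym same) b∈)
  entry-edge {F} {T} {a} {b} (e , e∈F , inj₂ eq) a∉ b∈ = e ,
    ∈-setOf⁺ (enters? F T) (e∈F , differ , inj₁ (subst (λ v → label v ∈ T) (sym (cong proj₁ eq)) b∈)) ,
    λ e∈ → [ (λ p∈ → proj₂ (∈-remove⁻ T p∈) (cong label (cong proj₁ eq))) ,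
             (λ q∈ → a∉ (proj₁ (∈-remove⁻ T (subst (λ v → label v ∈ T -ˢ label b) (cong proj₂ eq) q∈)))) ]′
           (proj₂ (proj₂ (∈-setOf⁻ (enters? F (T -ˢ label b)) e∈)))
    where
    differ : label (proj₁ (ends e)) ≢ label (proj₂ (ends e))
    differ same rewrite eq = a∉ (subst (_∈ T) same b∈)

  entering-mono : ∀ {F T T′} → T ⊆ T′ → entering F T ⊆ entering F T′
  entering-mono {F} {T} {T′} T⊆T′ e∈ = let e∈F , differ , touches = ∈-setOf⁻ (enters? F T) e∈ in
    ∈-setOf⁺ (enters? F T′) (e∈F , differ , [ inj₁ ∘ T⊆T′ , inj₂ ∘ T⊆T′ ]′ touches)

  -- A path from r to a part in T has an edge ab entering T; once the part of b
  -- is removed from T, that edge no longer enters, so it is not counted twice.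
  entered≤entering : ∀ fuel {F r T} → ∣ T ∣ ≤ fuel → label r ∉ T →
    (∀ {x} → x ∈ T → Path F r (representative x)) → ∣ T ∣ ≤ ∣ entering F T ∣
  entered≤entering zero bound r∉ path = ≤-trans bound z≤n
  entered≤entering (suc fuel) {F} {r} {T} bound r∉ path with nonempty? T
  ... | no T=∅ = subst (_≤ ∣ entering F T ∣) (sym (trans (cong ∣_∣ (Empty-unique T=∅)) (∣⊥∣≡0 size))) z≤n
  ... | yes (x , x∈T) =
    let a , b , adj , a∉ , b∈ = first-entry (path x∈T) r∉ (subst (_∈ T) (sym (label-part (proj₂ (nonempty x)))) x∈T)
        e , e∈ , e∉ = entry-edge adj a∉ b∈
        T′ = T -ˢ label b
        T′⊆T : T′ ⊆ T
        T′⊆T = p─q⊆p T ⁅ label b ⁆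
    in begin
      ∣ T ∣                    ≤⟨ ∣p∣≤1+∣p-x∣ T (label b) ⟩
      suc ∣ T′ ∣               ≤⟨ s≤s (entered≤entering fuel (s≤s⁻¹ (≤-trans (x∈p⇒∣p-x∣<∣p∣ b∈) bound))
                                    (r∉ ∘ T′⊆T) (λ x∈ → path (T′⊆T x∈))) ⟩
      suc ∣ entering F T′ ∣    ≤⟨ p⊂q⇒∣p∣<∣q∣ (entering-mono T′⊆T , e , e∈ , e∉) ⟩
      ∣ entering F T ∣         ∎
    where open ≤-Reasoning

  entering⊆ : ∀ {F T} → entering F T ⊆ F ∩ δ G P
  entering⊆ {F} {T} {e} e∈ = let e∈F , differ , _ = ∈-setOf⁻ (enters? F T) e∈ in
    x∈p∩q⁺ (e∈F , ∈-δ⁺ G P differ (proj₂ (covers (proj₁ (ends e)))) (proj₂ (covers (proj₂ (ends e)))))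

  module _ {C : Fin t → Subset m} (decomposition : IsDecomposition root C)
           (spanning : ∀ v → Spanning (rootsReaching root C v)) where
    open IsDecomposition decomposition using (component) renaming (disjoint to C-disjoint)

    Visits : Fin size → Fin t → Set
    Visits x i = root i ∉ part x × representative x ∈ Vᵣ (C i) (root i)

    visits? : ∀ x i → Dec (Visits x i)
    visits? x i = ¬? (root i ∈? part x) ×-dec (representative x ∈? Vᵣ (C i) (root i))

    -- It is enough to use spanning at one vertex of the part. A root reaching that vertex lies in
    -- the part or visits it from outside, and the visiting roots contribute at most their number to
    -- the rank.
    part-demand : ∀ x → rank ⊤ ≤ rank (rootsIn root (part x)) + ∣ setOf (visits? x) ∣
    part-demand x = begin
      rank ⊤                                                    ≡⟨ spanning (representative x) ⟨
      rank (rootsReaching root C (representative x))            ≤⟨ rank-∪-≤ reaching⊆ ⟩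
      rank (rootsIn root (part x)) + rank (setOf (visits? x))   ≤⟨ +-monoʳ-≤ _ (rank≤∣∣ (setOf (visits? x))) ⟩
      rank (rootsIn root (part x)) + ∣ setOf (visits? x) ∣      ∎
      where
      open ≤-Reasoning
      reaching⊆ : rootsReaching root C (representative x) ⊆ rootsIn root (part x) ∪ setOf (visits? x)
      reaching⊆ {i} i∈ with root i ∈? part x
      ... | yes r∈ = x∈p∪q⁺ (inj₁ (∈-setOf⁺ (λ i → root i ∈? part x) r∈))
      ... | no  r∉ = x∈p∪q⁺ (inj₂ (∈-setOf⁺ (visits? x) (r∉ , ∈-reaching⁻ root C (representative x) i∈)))

    -- Apply `entered≤entering` to the set of parts that root i visits. The part containing the root
    -- is not among them, and the component supplies paths from the root to the representatives.
    visited≤crossing : ∀ i → ∣ setOf (λ x → visits? x i) ∣ ≤ ∣ C i ∩ δ G P ∣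
    visited≤crossing i = ≤-trans
      (entered≤entering _ {C i} {root i} ≤-refl
        (λ r∈ → proj₁ (visited r∈) (proj₂ (covers (root i))))
        (λ x∈ → path-from-root (component i) (proj₂ (visited x∈))))
      (p⊆q⇒∣p∣≤∣q∣ (entering⊆ {C i}))
      where
      visited : ∀ {x} → x ∈ setOf (λ x → visits? x i) → Visits x i
      visited = ∈-setOf⁻ (λ x → visits? x i)

    -- Sum `part-demand` over the parts and count visits by root instead of by part. The components
    -- are disjoint, so their crossing edges together number at most ∣ δ ∣.
    necessity : rank ⊤ ℕ.* size ≤ ∣ δ G P ∣ + sum (λ x → rank (rootsIn root (part x)))
    necessity = begin
      rank ⊤ ℕ.* size
        ≡⟨ sum-const size (rank ⊤) ⟨
      sum (λ (x : Fin size) → rank ⊤)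
        ≤⟨ sum-mono part-demand ⟩
      sum (λ x → rank (rootsIn root (part x)) + ∣ setOf (visits? x) ∣)
        ≡⟨ sum-+ _ (λ x → ∣ setOf (visits? x) ∣) ⟩
      sum (λ x → rank (rootsIn root (part x))) + sum (λ x → ∣ setOf (visits? x) ∣)
        ≡⟨ cong (sum (λ x → rank (rootsIn root (part x))) +_) (double-counting visits?) ⟩
      sum (λ x → rank (rootsIn root (part x))) + sum (λ i → ∣ setOf (λ x → visits? x i) ∣)
        ≤⟨ +-monoʳ-≤ (sum (λ x → rank (rootsIn root (part x)))) (sum-mono visited≤crossing) ⟩
      sum (λ x → rank (rootsIn root (part x))) + sum (λ i → ∣ C i ∩ δ G P ∣)
        ≤⟨ +-monoʳ-≤ (sum (λ x → rank (rootsIn root (part x))))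
             (∣∣-sum-disjoint (λ i → C i ∩ δ G P) (λ i → p∩q⊆q (C i) (δ G P))
               λ { {i} {j} i≢j (e , e∈) → C-disjoint i≢j (e , x∈p∩q⁺
                 (p∩q⊆p (C i) _ (p∩q⊆p (C i ∩ δ G P) _ e∈) , p∩q⊆p (C j) _ (p∩q⊆q (C i ∩ δ G P) _ e∈))) }) ⟩
      sum (λ x → rank (rootsIn root (part x))) + ∣ δ G P ∣
        ≡⟨ +-comm _ ∣ δ G P ∣ ⟩
      ∣ δ G P ∣ + sum (λ x → rank (rootsIn root (part x))) ∎
      where open ≤-Reasoning

-- The condition over the integers, and the equivalence

open import Data.Integer using (+_; _*_; _-_; _≥_)

-- The theorem subtracts in the integers, since the difference may be negative; the proof works in ℕ
-- with the subtracted sum moved to the other side.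
≤⇔-ℤ : ∀ a b c d → (a ℕ.* b ≤ c + d) ⇔ (+ c ≥ + a * + b - + d)
≤⇔-ℤ a b c d = mk⇔
  (λ le → ℤₚ.≤-trans (ℤₚ.≤-reflexive (cong (_- + d) (sym (ℤₚ.pos-* a b))))
    (ℤₚ.≤-trans (ℤₚ.+-monoˡ-≤ (ℤ.- + d) (ℤ.+≤+ le))
      (ℤₚ.≤-reflexive (cancel (+ c) (+ d)))))
  (λ le → ℤₚ.drop‿+≤+ (ℤₚ.≤-trans (ℤₚ.≤-reflexive (trans (ℤₚ.pos-* a b) (sym (restore (+ a * + b) (+ d)))))
    (ℤₚ.+-monoˡ-≤ (+ d) le)))
  where
  cancel : ∀ x y → x ℤ.+ y - y ≡ x
  cancel x y = trans (ℤₚ.+-assoc x y (ℤ.- y)) (trans (cong (λ z → x ℤ.+ z) (ℤₚ.+-inverseʳ y)) (ℤₚ.+-identityʳ x))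
  restore : ∀ x y → x - y ℤ.+ y ≡ x
  restore x y = trans (ℤₚ.+-assoc x (ℤ.- y) y) (trans (cong (λ z → x ℤ.+ z) (ℤₚ.+-inverseˡ y)) (ℤₚ.+-identityʳ x))

theorem5p1 : ∀ {n m t} (G : Graph n m) (root : Fin t → Fin n) (M : Matroid t) (k : ℕ) →
    Matroid.rank M ⊤ ≡ k → 1 ≤ k →
    (∃[ C ] Graph.IsDecomposition G root C ×
    (∀ v → Matroid.Spanning M (Graph.rootsReaching G root C v)))
    ⇔
    (∀ (P : Partition n) →
    + ∣ δ G P ∣ ≥
    + k * + Partition.size P
    - + sum (λ i → Matroid.rank M (rootsIn root (Partition.part P i))))
theorem5p1 G root M k refl 1≤k = mk⇔
  (λ { (C , decomposition , spanning) P →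
    Equivalence.to (over-ℤ P) (Necessity.necessity G root M P decomposition spanning) })
  (λ condition → Sufficiency.sufficiency G root M 1≤k λ P → Equivalence.from (over-ℤ P) (condition P))
  where
  over-ℤ = λ P → ≤⇔-ℤ k (Partition.size P) ∣ δ G P ∣
    (sum (λ i → Matroid.rank M (rootsIn root (Partition.part P i))))
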